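{- Let $\mathcal{S}^{+}$ be the set of primitive self-dual Fishburn matrices whose corner cell equals $1$, and define \[ \mathbf{S}^{+}(t,v,w,z)=\sum_{M\in\mathcal{S}^{+}} t^{\mathrm{mag}(M)} v^{\max(M)} w^{\mathrm{se}(M)} z^{\mathrm{dg}(M)}. \] With $V_n(a,b)=(a+1)(b+1)^n-1$, we have \[ \mathbf{S}^{+}(t,v,w,z)=\sum_{n\ge 0} t^{2n+1}\frac{1+tV_n(v,w)}{1+t^2V_n(v,w)}(1+z)^n(1+v)^n(1+w)^{\binom{n}{2}}\prod_{i=0}^{n-1}\frac{V_i(v,w)}{1+t^2V_i(v,w)}. \]
   Context: A Fishburn matrix is an upper-triangular square matrix of nonnegative integers in which every row and every column contains a nonzero entry; it is primitive if all entries are $0$ or $1$. Rows and columns of a $k\times k$ matrix are numbered $1,\dots,k$ top to bottom and left to right; $\mathrm{mag}(M)=k$. The corner cell is $(1,k)$. $M$ is self-dual if $M_{ij}=M_{k+1-j,k+1-i}$ for all $i,j$ (invariance under transposition along the anti-diagonal). A cell $(i,j)$ is a diagonal cell if $i+j=k+1$, and an SE-cell if $i+j>k+1$. Statistics: $\max(M)$ = sum of the last column excluding the corner cell; $\mathrm{se}(M)$ = sum of all SE-cells not in the last column; $\mathrm{dg}(M)$ = sum of all diagonal cells excluding the corner cell. The identity is one of formal power series. -}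

module Defs where

open import Data.Bool using (Bool; true; false; _∧_; _∨_; not; if_then_else_; _xor_)
open import Data.Nat as ℕ using (ℕ; zero; suc; _∸_; _≡ᵇ_; _≤ᵇ_)
open import Data.Nat.Combinatorics using (_C_)
open import Data.Integer as ℤ using (ℤ; +_; -_)
open import Data.Fin using (Fin; toℕ; opposite)
open import Data.List using (List; map; allFin; upTo; foldr)
open import Data.Bool.ListAction using (all; any)
open import Data.Vec.Functional using (_∷_)

-- A primitive k×k matrix: entries 0/1, encoded as Bool (true = 1).
-- Row/column with Fin index i corresponds to paper index toℕ i + 1.
PMat : ℕ → Set
PMat k = Fin k → Fin k → Bool

b2n : Bool → ℕ
b2n true  = 1
b2n false = 0

beq : Bool → Bool → Bool
beq x y = not (x xor y)

sumℕ : List ℕ → ℕ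
sumℕ = foldr ℕ._+_ 0

allCells : ∀ {k} → (Fin k → Fin k → Bool) → Bool
allCells {k} p = all (λ i → all (λ j → p i j) (allFin k)) (allFin k)

sumCells : ∀ {k} → (Fin k → Fin k → ℕ) → ℕ
sumCells {k} f = sumℕ (map (λ i → sumℕ (map (λ j → f i j) (allFin k)) ) (allFin k))

upperTri : ∀ {k} → PMat k → Bool
upperTri M = allCells (λ i j → not (M i j) ∨ (toℕ i ≤ᵇ toℕ j))

rowsNonzero : ∀ {k} → PMat k → Bool
rowsNonzero {k} M = all (λ i → any (λ j → M i j) (allFin k)) (allFin k)

colsNonzero : ∀ {k} → PMat k → Bool
colsNonzero {k} M = all (λ j → any (λ i → M i j) (allFin k)) (allFin k)

isFishburn : ∀ {k} → PMat k → Bool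
isFishburn M = upperTri M ∧ rowsNonzero M ∧ colsNonzero M

-- self-dual: M i j = M (k+1-j) (k+1-i)  (opposite i has toℕ = k-1-toℕ i)
isSelfDual : ∀ {k} → PMat k → Bool
isSelfDual M = allCells (λ i j → beq (M i j) (M (opposite j) (opposite i)))

-- paper cell (1,k) is Fin cell with toℕ i = 0 and toℕ j + 1 = k
isCorner : ∀ {k} → Fin k → Fin k → Bool
isCorner {k} i j = (toℕ i ≡ᵇ 0) ∧ (suc (toℕ j) ≡ᵇ k)

-- corner cell equals 1 (false for k = 0, where there is no corner cell)
cornerOne : ∀ {k} → PMat k → Bool
cornerOne {k} M = any (λ i → any (λ j → isCorner i j ∧ M i j) (allFin k)) (allFin k)

inSPlus : ∀ {k} → PMat k → Bool
inSPlus M = isFishburn M ∧ isSelfDual M ∧ cornerOne M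

isLastCol : ∀ {k} → Fin k → Bool
isLastCol {k} j = suc (toℕ j) ≡ᵇ k

-- diagonal cell: paper i + j = k + 1, i.e. toℕ i + toℕ j + 1 = k
isDiag : ∀ {k} → Fin k → Fin k → Bool
isDiag {k} i j = suc (toℕ i ℕ.+ toℕ j) ≡ᵇ k

-- SE cell: paper i + j > k + 1, i.e. toℕ i + toℕ j ≥ k
isSE : ∀ {k} → Fin k → Fin k → Bool
isSE {k} i j = k ≤ᵇ (toℕ i ℕ.+ toℕ j)

statMax : ∀ {k} → PMat k → ℕ
statMax M = sumCells (λ i j → if isLastCol j ∧ not (isCorner i j) then b2n (M i j) else 0)

statSe : ∀ {k} → PMat k → ℕ
statSe M = sumCells (λ i j → if isSE i j ∧ not (isLastCol j) then b2n (M i j) else 0)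

statDg : ∀ {k} → PMat k → ℕ
statDg M = sumCells (λ i j → if isDiag i j ∧ not (isCorner i j) then b2n (M i j) else 0)

Summer : Set → Set
Summer A = (A → ℕ) → ℕ

sumBool : Summer Bool
sumBool f = f false ℕ.+ f true

sumPi : ∀ {A} n → Summer A → Summer (Fin n → A)
sumPi zero    s f = f (λ ())
sumPi (suc n) s f = s (λ x → sumPi n s (λ g → f (x ∷ g)))

sumPMat : ∀ k → Summer (PMat k)
sumPMat k = sumPi k (sumPi k sumBool)

-- number of M ∈ S⁺ with mag M = k, max M = a, se M = b, dg M = c
countSPlus : ℕ → ℕ → ℕ → ℕ → ℕ
countSPlus k a b c = sumPMat k (λ M →
  b2n (inSPlus M ∧ (statMax M ≡ᵇ a) ∧ (statSe M ≡ᵇ b) ∧ (statDg M ≡ᵇ c)))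

-- coefficient of t^k v^a w^b z^c
FPS : Set
FPS = ℕ → ℕ → ℕ → ℕ → ℤ

sumℤ : List ℤ → ℤ
sumℤ = foldr ℤ._+_ (+ 0)

Σ≤ : ℕ → (ℕ → ℤ) → ℤ
Σ≤ n f = sumℤ (map f (upTo (suc n)))

mon : ℕ → ℕ → ℕ → ℕ → FPS
mon k a b c k' a' b' c' =
  if (k ≡ᵇ k') ∧ (a ≡ᵇ a') ∧ (b ≡ᵇ b') ∧ (c ≡ᵇ c') then + 1 else + 0

𝟙 𝕥 𝕧 𝕨 𝕫 : FPS
𝟙 = mon 0 0 0 0
𝕥 = mon 1 0 0 0
𝕧 = mon 0 1 0 0
𝕨 = mon 0 0 1 0
𝕫 = mon 0 0 0 1

infixl 6 _⊕_ _⊖_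
infixl 7 _⊗_
infixr 8 _^^_

_⊕_ : FPS → FPS → FPS
(f ⊕ g) k a b c = f k a b c ℤ.+ g k a b c

neg : FPS → FPS
neg f k a b c = - f k a b c

_⊖_ : FPS → FPS → FPS
f ⊖ g = f ⊕ neg g

_⊗_ : FPS → FPS → FPS
(f ⊗ g) k a b c =
  Σ≤ k λ k₁ → Σ≤ a λ a₁ → Σ≤ b λ b₁ → Σ≤ c λ c₁ →
    f k₁ a₁ b₁ c₁ ℤ.* g (k ∸ k₁) (a ∸ a₁) (b ∸ b₁) (c ∸ c₁)

_^^_ : FPS → ℕ → FPS
f ^^ zero  = 𝟙
f ^^ suc n = f ⊗ (f ^^ n)

prodBelow : ℕ → (ℕ → FPS) → FPS
prodBelow zero    F = 𝟙
prodBelow (suc n) F = prodBelow n F ⊗ F n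

-- 1/(1+X) = Σ_{m≥0} (-X)^m, valid whenever every monomial of X has
-- t-degree ≥ 1 (then (-X)^m contributes nothing to t^k for m > k).
recip1p : FPS → FPS
recip1p X k a b c = Σ≤ k λ m → (neg X ^^ m) k a b c

-- Σ_{n≥0} F n, valid when F n has t-order > n (terms with n > k do not
-- contribute to the coefficient of t^k).
sumSeries : (ℕ → FPS) → FPS
sumSeries F k a b c = Σ≤ k λ n → F n k a b c

Vser : ℕ → FPS → FPS → FPS
Vser n A B = (A ⊕ 𝟙) ⊗ (B ⊕ 𝟙) ^^ n ⊖ 𝟙

rhsTerm : ℕ → FPS
rhsTerm n =
  𝕥 ^^ (2 ℕ.* n ℕ.+ 1)
  ⊗ (𝟙 ⊕ 𝕥 ⊗ Vser n 𝕧 𝕨) ⊗ recip1p (𝕥 ^^ 2 ⊗ Vser n 𝕧 𝕨)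
  ⊗ (𝟙 ⊕ 𝕫) ^^ n ⊗ (𝟙 ⊕ 𝕧) ^^ n ⊗ (𝟙 ⊕ 𝕨) ^^ (n C 2)
  ⊗ prodBelow n (λ i → Vser i 𝕧 𝕨 ⊗ recip1p (𝕥 ^^ 2 ⊗ Vser i 𝕧 𝕨))

rhs : FPS
rhs = sumSeries rhsTerm

SPlusGF : FPS
SPlusGF k a b c = + countSPlus k a b c

{-# OPTIONS --safe #-}
module Submission where

-- Number the columns from the right. A self-dual upper triangular matrix then becomes a symmetric matrix supported on
-- p + q < size (indices from 0), its columns are its rows, and the cells of the anti-diagonal and the SE-cells are those with
-- p = q and p > q. Inclusion–exclusion over the set B of rows allowed to be nonzero makes the entries independent, so that
-- the matrices of size k + 1 contribute F_k(1 + v), where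
--   F_k(x) = Σ_{B ⊆ [k]} (−1)^(k − |B|) x^|B| (1 + z)^#{p ∈ B : 2p ≤ k} (1 + w)^#{p < q in B : p + q ≤ k}.
-- Here k is in no pair and 1 is in a pair with each of 2, …, k − 1, whence
--   F_k(x) = (x − 1) (x (1 + z) F_{k−2}(x (1 + w)) − F_{k−2}(x)).
-- For x_n = (1 + v)(1 + w)^n, so that x_n − 1 = V_n, the series Φ_n = Σ_k t^k F_k(x_n) satisfies
--   (1 + t² V_n) Φ_n = 1 + t V_n + t² V_n (1 + z) x_n Φ_{n+1},
-- and unrolling this from S⁺ = t Φ_0 gives the stated sum.

-- Nonemptiness of the rows is the only condition that does not concern just a cell and its mirror
-- image, so it is the one handled by inclusion-exclusion. For fixed B the sum over matrices
-- factors. The equal entries at (p, q) and (q, p), with p < q, are both 0, with weight 1, or both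
-- 1, which requires p, q ∈ B; then only (q, p) is seen by a statistic: by max if p = 0, by se
-- otherwise. The corner entry 1 forces row 0 into B, and its pairs with the other members of B
-- produce the argument 1 + v of F_k. The variable x stays free because an element paired with all
-- the remaining ones multiplies the weight of each chosen one by 1 + w. Replacing x by x (1 + w)
-- absorbs this, at the price of a recursion that does not close on a single value of x and has to
-- be followed along the x_n. Each step of the unrolling brings a factor t², so the remainder after
-- k + 1 steps does not reach the coefficient of t^k.

open import Defs
open import Algebra.Bundles using (CommutativeRing)
import Algebra.Properties.CommutativeMonoid.Sum as CMSum
import Algebra.Properties.CommutativeSemiring.Exp as Exp
import Algebra.Properties.Ring as RingProperties
import Algebra.Solver.Ring.NaturalCoefficients.Default as SemiringSolver
open import Data.Bool using (Bool; true; false; _∧_; _∨_; not; if_then_else_; T)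
open import Data.Bool.ListAction using (all; any)
open import Data.Bool.Properties using (T-∧; ∨-zeroʳ; ∨-identityʳ; ∧-identityʳ; ∧-zeroʳ)
open import Data.Fin using (Fin; zero; suc; toℕ; fromℕ; inject₁; opposite)
import Data.Fin.Permutation as Perm
import Data.Fin.Properties as Finₚ
open import Data.Integer as ℤ using (ℤ; +_)
import Data.Integer.Properties as ℤₚ
open import Data.List using (tabulate; map; allFin; applyUpTo)
import Data.List.Relation.Unary.All.Properties as Allₚ
import Data.List.Relation.Unary.Any.Properties as Anyₚ
open import Data.Nat as ℕ using (ℕ; zero; suc; _∸_; z≤n; s≤s; _<ᵇ_; _≤ᵇ_; _≡ᵇ_)
open import Data.Nat.Combinatorics using (_C_; nC1≡n; nCk+nC[k+1]≡[n+1]C[k+1])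
import Data.Nat.Properties as ℕₚ
open import Data.Product using (_,_; proj₁; proj₂; _×_; ∃)
open import Data.Unit using (tt)
open import Data.Vec.Functional using (_∷_)
open import Function using (_∘_; id; Equivalence)
open import Level using (0ℓ)
open import Relation.Binary.PropositionalEquality as ≡ using (_≡_)
import Relation.Binary.Reasoning.Setoid as SetoidReasoning

-- Power series

module Sums (R : CommutativeRing 0ℓ 0ℓ) where
  open CommutativeRing R hiding (zero)

  sumBelow : ℕ → (ℕ → Carrier) → Carrier
  sumBelow zero    f = 0#
  sumBelow (suc n) f = f 0 + sumBelow n (f ∘ suc)

  sumBelow-cong : ∀ n {f g : ℕ → Carrier} → (∀ i → i ℕ.< n → f i ≈ g i) → sumBelow n f ≈ sumBelow n g
  sumBelow-cong zero    f≈g = refl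
  sumBelow-cong (suc n) f≈g = +-cong (f≈g 0 (s≤s z≤n)) (sumBelow-cong n (λ i i<n → f≈g (suc i) (s≤s i<n)))

  sumBelow-snoc : ∀ n f → sumBelow (suc n) f ≈ sumBelow n f + f n
  sumBelow-snoc zero    f = +-comm _ _
  sumBelow-snoc (suc n) f = trans (+-congˡ (sumBelow-snoc n (f ∘ suc))) (sym (+-assoc _ _ _))

  *-distribˡ-sumBelow : ∀ c n f → c * sumBelow n f ≈ sumBelow n (λ i → c * f i)
  *-distribˡ-sumBelow c zero    f = zeroʳ c
  *-distribˡ-sumBelow c (suc n) f = trans (distribˡ c _ _) (+-congˡ (*-distribˡ-sumBelow c n (f ∘ suc)))

  sumBelow-≤ : ∀ k n (F : ℕ → Carrier) → k ℕ.≤ n → (∀ i → k ℕ.≤ i → F i ≈ 0#) → sumBelow k F ≈ sumBelow n F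
  sumBelow-≤ zero    zero    F z≤n F0 = refl
  sumBelow-≤ zero    (suc n) F z≤n F0 =
    trans (sym (+-identityˡ _)) (+-cong (sym (F0 0 z≤n)) (sumBelow-≤ zero n (F ∘ suc) z≤n (λ i _ → F0 (suc i) z≤n)))
  sumBelow-≤ (suc k) (suc n) F (s≤s k≤n) F0 = +-congˡ (sumBelow-≤ k n (F ∘ suc) k≤n (λ i k≤i → F0 (suc i) (s≤s k≤i)))

module PowerSeries (R : CommutativeRing 0ℓ 0ℓ) where
  open CommutativeRing R hiding (zero)
  open SetoidReasoning setoid
  open SemiringSolver commutativeSemiring
  open Sums R

  Series : Set
  Series = ℕ → Carrier

  infixl 7 _∙_
  -- The Cauchy product, by recursion on the shift of the left factor: the ring laws then follow by
  -- induction, without truncated subtraction. `∙-sumBelow` recovers the usual form.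
  _∙_ : Series → Series → Series
  (f ∙ g) zero    = f 0 * g 0
  (f ∙ g) (suc n) = f 0 * g (suc n) + ((f ∘ suc) ∙ g) n

  const : Carrier → Series
  const c zero    = c
  const c (suc n) = 0#

  X : Series
  X zero    = 0#
  X (suc n) = const 1# n

  -- Degree n of a product sees only degrees up to n of its factors. This bounded form is what
  -- allows a factor to be replaced by a truncation, or by 0 below its order.
  ∙-cong≤ : ∀ n {f f′ g g′} → (∀ i → i ℕ.≤ n → f i ≈ f′ i) → (∀ i → i ℕ.≤ n → g i ≈ g′ i) →
            (f ∙ g) n ≈ (f′ ∙ g′) n
  ∙-cong≤ zero    p q = *-cong (p 0 z≤n) (q 0 z≤n)
  ∙-cong≤ (suc n) p q = +-cong (*-cong (p 0 z≤n) (q (suc n) ℕₚ.≤-refl))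
    (∙-cong≤ n (λ i i≤n → p (suc i) (s≤s i≤n)) (λ i i≤n → q i (ℕₚ.m≤n⇒m≤1+n i≤n)))

  ∙-cong : ∀ {f f′ g g′ : Series} → (∀ i → f i ≈ f′ i) → (∀ i → g i ≈ g′ i) → ∀ n → (f ∙ g) n ≈ (f′ ∙ g′) n
  ∙-cong p q n = ∙-cong≤ n (λ i _ → p i) (λ i _ → q i)

  ∙-distribʳ : ∀ h f g n → ((λ i → f i + g i) ∙ h) n ≈ (f ∙ h) n + (g ∙ h) n
  ∙-distribʳ h f g zero    = distribʳ _ _ _
  ∙-distribʳ h f g (suc n) = trans (+-congˡ (∙-distribʳ h (f ∘ suc) (g ∘ suc) n))
    (solve 5 (λ a b c d e → (a :+ b) :* c :+ (d :+ e) := (a :* c :+ d) :+ (b :* c :+ e)) refl _ _ _ _ _)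

  ∙-scaleˡ : ∀ c f g n → ((λ i → c * f i) ∙ g) n ≈ c * (f ∙ g) n
  ∙-scaleˡ c f g zero    = *-assoc _ _ _
  ∙-scaleˡ c f g (suc n) = trans (+-cong (*-assoc _ _ _) (∙-scaleˡ c (f ∘ suc) g n)) (sym (distribˡ _ _ _))

  ∙-assoc : ∀ f g h n → ((f ∙ g) ∙ h) n ≈ (f ∙ (g ∙ h)) n
  ∙-assoc f g h zero    = *-assoc _ _ _
  ∙-assoc f g h (suc n) = begin
    f 0 * g 0 * h (suc n) + ((λ i → f 0 * g (suc i) + ((f ∘ suc) ∙ g) i) ∙ h) n
      ≈⟨ +-congˡ (∙-distribʳ h _ _ n) ⟩
    f 0 * g 0 * h (suc n) + (((λ i → f 0 * g (suc i)) ∙ h) n + (((f ∘ suc) ∙ g) ∙ h) n)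
      ≈⟨ +-congˡ (+-cong (∙-scaleˡ (f 0) (g ∘ suc) h n) (∙-assoc (f ∘ suc) g h n)) ⟩
    f 0 * g 0 * h (suc n) + (f 0 * ((g ∘ suc) ∙ h) n + ((f ∘ suc) ∙ (g ∙ h)) n)
      ≈⟨ solve 5 (λ a b c d e → a :* b :* c :+ (a :* d :+ e) := a :* (b :* c :+ d) :+ e) refl _ _ _ _ _ ⟩
    f 0 * (g 0 * h (suc n) + ((g ∘ suc) ∙ h) n) + ((f ∘ suc) ∙ (g ∙ h)) n ∎

  -- The defining recursion seen from the right factor; commutativity is the comparison of the two.
  ∙-sucʳ : ∀ f g n → (f ∙ g) (suc n) ≈ f (suc n) * g 0 + (f ∙ (g ∘ suc)) n
  ∙-sucʳ f g zero    = +-comm _ _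
  ∙-sucʳ f g (suc n) = trans (+-congˡ (∙-sucʳ (f ∘ suc) g n))
    (solve 3 (λ a b c → a :+ (b :+ c) := b :+ (a :+ c)) refl _ _ _)

  ∙-comm : ∀ f g n → (f ∙ g) n ≈ (g ∙ f) n
  ∙-comm f g zero    = *-comm _ _
  ∙-comm f g (suc n) = trans (+-cong (*-comm _ _) (∙-comm (f ∘ suc) g n)) (sym (∙-sucʳ g f n))

  ∙-zeroˡ : ∀ g n → ((λ _ → 0#) ∙ g) n ≈ 0#
  ∙-zeroˡ g zero    = zeroˡ _
  ∙-zeroˡ g (suc n) = trans (+-cong (zeroˡ _) (∙-zeroˡ g n)) (+-identityˡ _)

  const-∙ : ∀ c f n → (const c ∙ f) n ≈ c * f n
  const-∙ c f zero    = refl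
  const-∙ c f (suc n) = trans (+-congˡ (∙-zeroˡ f n)) (+-identityʳ _)

  ∙-identityˡ : ∀ f n → (const 1# ∙ f) n ≈ f n
  ∙-identityˡ f n = trans (const-∙ 1# f n) (*-identityˡ _)

  seriesRing : CommutativeRing 0ℓ 0ℓ
  seriesRing = record
    { Carrier = Series
    ; _≈_ = λ f g → ∀ n → f n ≈ g n
    ; _+_ = λ f g n → f n + g n
    ; _*_ = _∙_
    ; -_ = λ f n → - f n
    ; 0# = λ _ → 0#
    ; 1# = const 1#
    ; isCommutativeRing = record
      { isRing = record
        { +-isAbelianGroup = record
          { isGroup = record
            { isMonoid = record
              { isSemigroup = record
                { isMagma = record
                  { isEquivalence = record
                    { refl = λ n → refl
                    ; sym = λ p n → sym (p n)
                    ; trans = λ p q n → trans (p n) (q n) }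
                  ; ∙-cong = λ p q n → +-cong (p n) (q n) }
                ; assoc = λ f g h n → +-assoc _ _ _ }
              ; identity = (λ f n → +-identityˡ _) , (λ f n → +-identityʳ _) }
            ; inverse = (λ f n → -‿inverseˡ _) , (λ f n → -‿inverseʳ _)
            ; ⁻¹-cong = λ p n → -‿cong (p n) }
          ; comm = λ f g n → +-comm _ _ }
        ; *-cong = ∙-cong
        ; *-assoc = ∙-assoc
        ; *-identity = ∙-identityˡ , (λ f n → trans (∙-comm f _ n) (∙-identityˡ f n))
        ; distrib = (λ f g h n → trans (∙-comm f _ n) (trans (∙-distribʳ f g h n) (+-cong (∙-comm g f n) (∙-comm h f n))))
                  , ∙-distribʳ }
      ; *-comm = ∙-comm } }

  X∙-suc : ∀ f n → (X ∙ f) (suc n) ≈ f n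
  X∙-suc f n = trans (+-cong (zeroˡ _) (∙-identityˡ f n)) (+-identityˡ _)

  ∙-sumBelow : ∀ f g n → (f ∙ g) n ≈ sumBelow (suc n) (λ i → f i * g (n ∸ i))
  ∙-sumBelow f g zero    = sym (+-identityʳ _)
  ∙-sumBelow f g (suc n) = +-congˡ (∙-sumBelow (f ∘ suc) g n)

  module S = CommutativeRing seriesRing
  module SS = Sums seriesRing
  open Exp S.commutativeSemiring using (_^_)
  module E = Exp commutativeSemiring

  sumBelow-coeff : ∀ n (F : ℕ → Series) k → SS.sumBelow n F k ≈ sumBelow n (λ i → F i k)
  sumBelow-coeff zero    F k = refl
  sumBelow-coeff (suc n) F k = +-congˡ (sumBelow-coeff n (F ∘ suc) k)

  const-* : ∀ a b n → const (a * b) n ≈ (const a ∙ const b) n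
  const-* a b zero    = refl
  const-* a b (suc n) = sym (trans (const-∙ a (const b) (suc n)) (zeroʳ a))

  const-+ : ∀ a b n → const (a + b) n ≈ const a n + const b n
  const-+ a b zero    = refl
  const-+ a b (suc n) = sym (+-identityˡ _)

  const-neg : ∀ a n → const (- a) n ≈ - const a n
  const-neg a zero    = refl
  const-neg a (suc n) = sym (RingProperties.-0#≈0# ring)

  const-cong : ∀ {a b} → a ≈ b → ∀ n → const a n ≈ const b n
  const-cong a≈b zero    = a≈b
  const-cong a≈b (suc n) = refl

  const-^ : ∀ a m n → const (a E.^ m) n ≈ (const a ^ m) n
  const-^ a zero    n = refl
  const-^ a (suc m) n = trans (const-* a _ n) (∙-cong (λ i → refl) (const-^ a m) n)

  ∙-suc₀ : ∀ f g n → f 0 ≈ 0# → (f ∙ g) (suc n) ≈ ((f ∘ suc) ∙ g) n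
  ∙-suc₀ f g n f0 = trans (+-congʳ (trans (*-congʳ f0) (zeroˡ _))) (+-identityˡ _)

  -- A factor without constant term raises the order by at least one. Both the geometric series and
  -- the remainder of the unrolling rest on this.
  ∙-vanishes-suc : ∀ f g m → f 0 ≈ 0# → (∀ i → i ℕ.< m → g i ≈ 0#) → ∀ i → i ℕ.< suc m → (f ∙ g) i ≈ 0#
  ∙-vanishes-suc f g m f0 g< zero    _ = trans (*-congʳ f0) (zeroˡ _)
  ∙-vanishes-suc f g m f0 g< (suc i) (s≤s i<m) = begin
    (f ∙ g) (suc i)                       ≈⟨ ∙-suc₀ f g i f0 ⟩
    ((f ∘ suc) ∙ g) i                     ≈⟨ ∙-comm (f ∘ suc) g i ⟩
    (g ∙ (f ∘ suc)) i                     ≈⟨ ∙-cong≤ i (λ j j≤i → g< j (ℕₚ.≤-<-trans j≤i i<m)) (λ j _ → refl) ⟩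
    ((λ _ → 0#) ∙ (f ∘ suc)) i            ≈⟨ ∙-zeroˡ _ i ⟩
    0# ∎

  ^-vanishes : ∀ f → f 0 ≈ 0# → ∀ m i → i ℕ.< m → (f ^ m) i ≈ 0#
  ^-vanishes f f0 (suc m) = ∙-vanishes-suc f (f ^ m) m f0 (^-vanishes f f0 m)

  -- 1/(1 - f) for `f 0 ≈ 0#`: the m-th power then has order at least m, so the powers up to k
  -- determine degree k. The cutoff depends on k in the same way as in `recip1p`.
  geometric : Series → Series
  geometric f k = sumBelow (suc k) (λ m → (f ^ m) k)

  geometric-partial : ∀ f → f 0 ≈ 0# → ∀ k j → j ℕ.≤ k → geometric f j ≈ SS.sumBelow (suc k) (f ^_) j
  geometric-partial f f0 k j j≤k = trans
    (sumBelow-≤ (suc j) (suc k) (λ m → (f ^ m) j) (s≤s j≤k) (λ i j<i → ^-vanishes f f0 i j j<i))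
    (sym (sumBelow-coeff (suc k) (f ^_) j))

  -- At degree k the geometric series may be replaced by its partial sum, which is shifted by multiplication with f.
  geometric-unfold : ∀ f → f 0 ≈ 0# → geometric f S.≈ (S.1# S.+ f S.* geometric f)
  geometric-unfold f f0 zero    = trans (+-identityʳ _) (sym (trans (+-congˡ (trans (*-congʳ f0) (zeroˡ _))) (+-identityʳ _)))
  geometric-unfold f f0 (suc k) = begin
    0# + sumBelow (suc k) (λ m → (f ∙ (f ^ m)) (suc k))
      ≈⟨ +-congˡ (sumBelow-cong (suc k) {g = λ m → ((f ∘ suc) ∙ (f ^ m)) k} (λ m _ → ∙-suc₀ f (f ^ m) k f0)) ⟩
    0# + sumBelow (suc k) (λ m → ((f ∘ suc) ∙ (f ^ m)) k)
      ≈⟨ +-congˡ (sumBelow-coeff (suc k) (λ m → (f ∘ suc) ∙ (f ^ m)) k) ⟨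
    0# + SS.sumBelow (suc k) (λ m → (f ∘ suc) ∙ (f ^ m)) k
      ≈⟨ +-congˡ (SS.*-distribˡ-sumBelow (f ∘ suc) (suc k) (f ^_) k) ⟨
    0# + ((f ∘ suc) ∙ SS.sumBelow (suc k) (f ^_)) k
      ≈⟨ +-congˡ (∙-cong≤ k (λ i _ → refl) (geometric-partial f f0 k)) ⟨
    0# + ((f ∘ suc) ∙ geometric f) k
      ≈⟨ +-congˡ (∙-suc₀ f (geometric f) k f0) ⟨
    0# + (f ∙ geometric f) (suc k) ∎

-- Sums over functions on finite sets

-- The recursion for row sets removes the first and the last index together, so functions must also
-- be extended at the far end.
snoc : ∀ {A : Set} {n} → (Fin n → A) → A → Fin (suc n) → A
snoc {n = zero}  g x _       = x
snoc {n = suc n} g x zero    = g zero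
snoc {n = suc n} g x (suc i) = snoc (g ∘ suc) x i

snoc-inject₁ : ∀ {A : Set} {n} (g : Fin n → A) x i → snoc g x (inject₁ i) ≡ g i
snoc-inject₁ g x zero    = ≡.refl
snoc-inject₁ g x (suc i) = snoc-inject₁ (g ∘ suc) x i

snoc-last : ∀ {A : Set} n (g : Fin n → A) x → snoc g x (fromℕ n) ≡ x
snoc-last zero    g x = ≡.refl
snoc-last (suc n) g x = snoc-last n (g ∘ suc) x

∷-inject₁ : ∀ {A : Set} {n} x (g : Fin (suc n) → A) i → (x ∷ g) (inject₁ i) ≡ (x ∷ (g ∘ inject₁)) i
∷-inject₁ x g zero    = ≡.refl
∷-inject₁ x g (suc i) = ≡.refl

∷-opposite : ∀ {A : Set} {n} x (g : Fin n → A) i → snoc (g ∘ opposite) x i ≡ (x ∷ g) (opposite i)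
∷-opposite {n = zero}  x g zero    = ≡.refl
∷-opposite {n = suc n} x g zero    = ≡.refl
∷-opposite {n = suc n} x g (suc i) =
  ≡.trans (∷-opposite x (g ∘ inject₁) i) (≡.sym (∷-inject₁ x g (opposite i)))

∷-cong : ∀ {A : Set} {n} {_~_ : A → A → Set} {x y : A} {g h : Fin n → A} →
         x ~ y → (∀ i → g i ~ h i) → ∀ i → (x ∷ g) i ~ (y ∷ h) i
∷-cong p q zero    = p
∷-cong p q (suc i) = q i

module Enumeration (R : CommutativeRing 0ℓ 0ℓ) where
  open CommutativeRing R hiding (zero)
  open SetoidReasoning setoid
  open SemiringSolver commutativeSemiring
  open CMSum *-commutativeMonoid public
    renaming (sum to ∏; sum-cong-≋ to ∏-cong; ∑-distrib-+ to ∏-distrib-*; sum-init-last to ∏-init-last; sum-permute to ∏-permute)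
    using ()

  -- `swap` ranges over all extensional additive functionals and not over other summations: the
  -- record does not refer to itself, and `fubini` is the special case of a second summation.
  record Summation (A : Set) : Set₁ where
    field
      ∑     : (A → Carrier) → Carrier
      cong  : ∀ {f g} → (∀ x → f x ≈ g x) → ∑ f ≈ ∑ g
      plus  : ∀ f g → ∑ (λ x → f x + g x) ≈ ∑ f + ∑ g
      scale : ∀ c f → ∑ (λ x → c * f x) ≈ c * ∑ f
      swap  : ∀ {B : Set} (s : (B → Carrier) → Carrier) →
              (∀ {f g} → (∀ y → f y ≈ g y) → s f ≈ s g) →
              (∀ f g → s (λ y → f y + g y) ≈ s f + s g) →
              ∀ (f : A → B → Carrier) → ∑ (λ x → s (f x)) ≈ s (λ y → ∑ (λ x → f x y))

  open Summation

  fubini : ∀ {A B : Set} (s : Summation A) (t : Summation B) (f : A → B → Carrier) →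
           ∑ s (λ x → ∑ t (f x)) ≈ ∑ t (λ y → ∑ s (λ x → f x y))
  fubini s t = swap s (∑ t) (cong t) (plus t)

  bool : Summation Bool
  bool .∑ f        = f false + f true
  bool .cong p     = +-cong (p false) (p true)
  bool .plus f g   = solve 4 (λ a b c d → (a :+ b) :+ (c :+ d) := (a :+ c) :+ (b :+ d)) refl _ _ _ _
  bool .scale c f  = sym (distribˡ c _ _)
  bool .swap s s-cong s-plus f = sym (s-plus (f false) (f true))

  pi : ∀ {A} n → Summation A → Summation (Fin n → A)
  pi zero    s .∑ f = f (λ ())
  pi zero    s .cong p = p (λ ())
  pi zero    s .plus f g = refl
  pi zero    s .scale c f = refl
  pi zero    s .swap t _ _ f = refl
  pi (suc n) s .∑ f = ∑ s (λ x → ∑ (pi n s) (λ g → f (x ∷ g)))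
  pi (suc n) s .cong p = cong s (λ x → cong (pi n s) (λ g → p (x ∷ g)))
  pi (suc n) s .plus f g = trans (cong s (λ x → plus (pi n s) _ _)) (plus s _ _)
  pi (suc n) s .scale c f = trans (cong s (λ x → scale (pi n s) c _)) (scale s c _)
  pi (suc n) s .swap t t-cong t-plus f =
    trans (cong s (λ x → swap (pi n s) t t-cong t-plus _)) (swap s t t-cong t-plus _)

  scaleʳ : ∀ {A} (s : Summation A) c f → ∑ s (λ x → f x * c) ≈ ∑ s f * c
  scaleʳ s c f = trans (cong s (λ x → *-comm _ c)) (trans (scale s c f) (*-comm c _))

  ∑-0 : ∀ {A} (s : Summation A) → ∑ s (λ _ → 0#) ≈ 0#
  ∑-0 s = trans (cong s (λ _ → sym (zeroˡ 0#))) (trans (scale s 0# (λ _ → 0#)) (zeroˡ _))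

  -- Serves to move the sum over row sets outside the sum over matrices.
  exchange : ∀ {A B} (s : Summation A) (t : Summation B) (f : A → Carrier) (g : B → Carrier) (h : A → B → Carrier) →
    ∑ s (λ x → f x * ∑ t (λ y → g y * h x y)) ≈ ∑ t (λ y → g y * ∑ s (λ x → f x * h x y))
  exchange s t f g h = begin
    ∑ s (λ x → f x * ∑ t (λ y → g y * h x y))
      ≈⟨ cong s (λ x → sym (scale t _ _)) ⟩
    ∑ s (λ x → ∑ t (λ y → f x * (g y * h x y)))
      ≈⟨ fubini s t _ ⟩
    ∑ t (λ y → ∑ s (λ x → f x * (g y * h x y)))
      ≈⟨ cong t (λ y → trans (cong s (λ x → solve 3 (λ a b c → a :* (b :* c) := b :* (a :* c)) refl _ _ _)) (scale s _ _)) ⟩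
    ∑ t (λ y → g y * ∑ s (λ x → f x * h x y)) ∎

  ∑-∏ : ∀ {A} n (s : Summation A) (h : Fin n → A → Carrier) →
        ∑ (pi n s) (λ g → ∏ (λ i → h i (g i))) ≈ ∏ (λ i → ∑ s (h i))
  ∑-∏ zero    s h = refl
  ∑-∏ (suc n) s h = begin
    ∑ s (λ x → ∑ (pi n s) (λ g → h zero x * ∏ (λ i → h (suc i) (g i))))
      ≈⟨ cong s (λ x → trans (scale (pi n s) _ _) (*-congˡ (∑-∏ n s (h ∘ suc)))) ⟩
    ∑ s (λ x → h zero x * ∏ (λ i → ∑ s (h (suc i))))
      ≈⟨ scaleʳ s _ _ ⟩
    ∑ s (h zero) * ∏ (λ i → ∑ s (h (suc i))) ∎

  -- Reindexing yields functions that agree only pointwise, so a summand has to respect pointwise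
  -- equality.
  Extensional : ∀ {A : Set} {n} → ((Fin n → A) → Carrier) → Set
  Extensional {A} {n} F = ∀ {g h : Fin n → A} → (∀ i → g i ≡ h i) → F g ≈ F h

  ∑-snoc : ∀ {A} n (s : Summation A) {F} → Extensional F →
           ∑ (pi (suc n) s) F ≈ ∑ s (λ x → ∑ (pi n s) (λ g → F (snoc g x)))
  ∑-snoc zero    s ext = cong s (λ x → ext λ { zero → ≡.refl })
  ∑-snoc (suc n) s {F} ext = begin
    ∑ s (λ y → ∑ (pi (suc n) s) (λ g → F (y ∷ g)))
      ≈⟨ cong s (λ y → ∑-snoc n s (λ eq → ext (∷-cong {_~_ = _≡_} ≡.refl eq))) ⟩
    ∑ s (λ y → ∑ s (λ x → ∑ (pi n s) (λ g → F (y ∷ snoc g x))))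
      ≈⟨ fubini s s _ ⟩
    ∑ s (λ x → ∑ s (λ y → ∑ (pi n s) (λ g → F (y ∷ snoc g x))))
      ≈⟨ cong s (λ x → cong s (λ y → cong (pi n s) (λ g → ext λ { zero → ≡.refl ; (suc i) → ≡.refl }))) ⟩
    ∑ s (λ x → ∑ s (λ y → ∑ (pi n s) (λ g → F (snoc (y ∷ g) x)))) ∎

  -- Reversal sends the first value to the end, which reduces the claim to `∑-snoc` and the
  -- induction hypothesis.
  ∑-reverse : ∀ {A} n (s : Summation A) {F} → Extensional F →
              ∑ (pi n s) (λ g → F (g ∘ opposite)) ≈ ∑ (pi n s) F
  ∑-reverse zero    s ext = ext (λ ())
  ∑-reverse (suc n) s {F} ext = begin
    ∑ s (λ x → ∑ (pi n s) (λ g → F ((x ∷ g) ∘ opposite)))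
      ≈⟨ cong s (λ x → cong (pi n s) (λ g → ext (λ i → ≡.sym (∷-opposite x g i)))) ⟩
    ∑ s (λ x → ∑ (pi n s) (λ g → F (snoc (g ∘ opposite) x)))
      ≈⟨ cong s (λ x → ∑-reverse n s (λ eq → ext (snoc-cong eq))) ⟩
    ∑ s (λ x → ∑ (pi n s) (λ g → F (snoc g x)))
      ≈⟨ ∑-snoc n s ext ⟨
    ∑ (pi (suc n) s) F ∎
    where
    snoc-cong : ∀ {n x} {g h : Fin n → _} → (∀ i → g i ≡ h i) → ∀ i → snoc g x i ≡ snoc h x i
    snoc-cong {zero}  eq i       = ≡.refl
    snoc-cong {suc n} eq zero    = eq zero
    snoc-cong {suc n} eq (suc i) = snoc-cong (eq ∘ suc) i

  Extensional₂ : ∀ {A : Set} {m n} → ((Fin m → Fin n → A) → Carrier) → Set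
  Extensional₂ {A} {m} {n} F = ∀ {g h : Fin m → Fin n → A} → (∀ i j → g i j ≡ h i j) → F g ≈ F h

  ∑-reverse-columns : ∀ {A} (s : Summation A) m n {F} → Extensional₂ F →
    ∑ (pi m (pi n s)) (λ N → F (λ i j → N i (opposite j))) ≈ ∑ (pi m (pi n s)) F
  ∑-reverse-columns s zero    n ext = ext (λ ())
  ∑-reverse-columns s (suc m) n {F} ext = begin
    ∑ (pi n s) (λ r → ∑ (pi m (pi n s)) (λ N → F (λ i j → (r ∷ N) i (opposite j))))
      ≈⟨ cong (pi n s) (λ r → cong (pi m (pi n s)) (λ N → ext λ { zero j → ≡.refl ; (suc i) j → ≡.refl })) ⟩
    ∑ (pi n s) (λ r → ∑ (pi m (pi n s)) (λ N → F ((r ∘ opposite) ∷ (λ i j → N i (opposite j)))))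
      ≈⟨ cong (pi n s) (λ r → ∑-reverse-columns s m n (λ eq → ext λ { zero j → ≡.refl ; (suc i) j → eq i j })) ⟩
    ∑ (pi n s) (λ r → ∑ (pi m (pi n s)) (λ N → F ((r ∘ opposite) ∷ N)))
      ≈⟨ ∑-reverse n s {λ r → ∑ (pi m (pi n s)) (λ N → F (r ∷ N))}
           (λ eq → cong (pi m (pi n s)) (λ N → ext λ { zero j → eq j ; (suc i) j → ≡.refl })) ⟩
    ∑ (pi n s) (λ r → ∑ (pi m (pi n s)) (λ N → F (r ∷ N))) ∎

  ∑-first-column : ∀ {A} (s : Summation A) n m {F} → Extensional₂ F →
    ∑ (pi n (pi (suc m) s)) F ≈ ∑ (pi n s) (λ c → ∑ (pi n (pi m s)) (λ N → F (λ i → c i ∷ N i)))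
  ∑-first-column s zero    m ext = ext (λ ())
  ∑-first-column s (suc n) m {F} ext = begin
    ∑ s (λ x → ∑ (pi m s) (λ r → ∑ (pi n (pi (suc m) s)) (λ M → F ((x ∷ r) ∷ M))))
      ≈⟨ cong s (λ x → cong (pi m s) (λ r → ∑-first-column s n m
           (λ eq → ext λ { zero j → ≡.refl ; (suc i) j → eq i j }))) ⟩
    ∑ s (λ x → ∑ (pi m s) (λ r → ∑ (pi n s) (λ c → ∑ (pi n (pi m s)) (λ N → F ((x ∷ r) ∷ (λ i → c i ∷ N i))))))
      ≈⟨ cong s (λ x → fubini (pi m s) (pi n s) _) ⟩
    ∑ s (λ x → ∑ (pi n s) (λ c → ∑ (pi m s) (λ r → ∑ (pi n (pi m s)) (λ N → F ((x ∷ r) ∷ (λ i → c i ∷ N i))))))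
      ≈⟨ cong s (λ x → cong (pi n s) (λ c → cong (pi m s) (λ r → cong (pi n (pi m s)) (λ N →
           ext λ { zero j → ≡.refl ; (suc i) j → ≡.refl })))) ⟩
    ∑ s (λ x → ∑ (pi n s) (λ c → ∑ (pi m s) (λ r → ∑ (pi n (pi m s)) (λ N → F (λ i → (x ∷ c) i ∷ (r ∷ N) i))))) ∎

  -- One factor for each free cell of a symmetric matrix: `D` on the diagonal and `O` once for each
  -- pair p < q.
  triangleProd : ∀ n → (Fin n → Carrier) → (Fin n → Fin n → Carrier) → Carrier
  triangleProd zero    D O = 1#
  triangleProd (suc n) D O =
    D zero * ∏ (λ q → O zero (suc q)) * triangleProd n (D ∘ suc) (λ p q → O (suc p) (suc q))

  triangleProd-cong : ∀ n {D D′ : Fin n → Carrier} {O O′ : Fin n → Fin n → Carrier} → (∀ p → D p ≈ D′ p) →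
                      (∀ p q → toℕ p ℕ.< toℕ q → O p q ≈ O′ p q) → triangleProd n D O ≈ triangleProd n D′ O′
  triangleProd-cong zero    d o = refl
  triangleProd-cong (suc n) d o = *-cong (*-cong (d zero) (∏-cong (λ q → o zero (suc q) (s≤s z≤n))))
    (triangleProd-cong n (d ∘ suc) (λ p q p<q → o (suc p) (suc q) (s≤s p<q)))

  triangleProd-init : ∀ n (D : Fin (suc n) → Carrier) (O : Fin (suc n) → Fin (suc n) → Carrier) →
    D (fromℕ n) ≈ 1# → (∀ p → O p (fromℕ n) ≈ 1#) →
    triangleProd (suc n) D O ≈ triangleProd n (D ∘ inject₁) (λ p q → O (inject₁ p) (inject₁ q))
  triangleProd-init zero    D O d o = trans (*-congʳ (*-congʳ d)) (trans (*-identityʳ _) (*-identityʳ _))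
  triangleProd-init (suc n) D O d o = *-cong
    (*-congˡ (trans (∏-init-last (λ q → O zero (suc q))) (trans (*-congˡ (o zero)) (*-identityʳ _))))
    (triangleProd-init n (D ∘ suc) (λ p q → O (suc p) (suc q)) d (o ∘ suc))

  -- The factors at (p, q) and (q, p) involve only the two entries there, so distinct pairs are
  -- independent. All matrices are summed; symmetry will enter as a factor that vanishes on unequal
  -- entries. The induction splits off the first row and column: the corner stands alone, the rest
  -- of the row is coupled entrywise to the rest of the column, and the remaining block is a smaller
  -- instance.
  ∑-∏-pairs : ∀ {A} (s : Summation A) k (θ : Fin k → Fin k → A → A → Carrier) →
    ∑ (pi k (pi k s)) (λ N → ∏ (λ p → ∏ (λ q → θ p q (N p q) (N q p)))) ≈
    triangleProd k (λ p → ∑ s (λ x → θ p p x x))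
                   (λ p q → ∑ s (λ x → ∑ s (λ y → θ p q x y * θ q p y x)))
  ∑-∏-pairs s zero    θ = refl
  ∑-∏-pairs {A} s (suc k) θ = begin
    ∑ s (λ x → ∑ (pi k s) (λ r → ∑ (pi k (pi (suc k) s)) (λ M → G ((x ∷ r) ∷ M))))
      ≈⟨ cong s (λ x → cong (pi k s) (λ r → ∑-first-column s k k (λ {M} {M′} eq → G-ext {(x ∷ r) ∷ M} {(x ∷ r) ∷ M′} λ { zero j → ≡.refl ; (suc i) j → eq i j }))) ⟩
    ∑ s (λ x → ∑ (pi k s) (λ r → ∑ (pi k s) (λ c → ∑ (pi k (pi k s)) (λ N → G ((x ∷ r) ∷ (λ p → c p ∷ N p))))))
      ≈⟨ cong s (λ x → cong (pi k s) (λ r → cong (pi k s) (λ c → cong (pi k (pi k s)) (λ N → split x r c N)))) ⟩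
    ∑ s (λ x → ∑ (pi k s) (λ r → ∑ (pi k s) (λ c → ∑ (pi k (pi k s)) (λ N → a x * (∏ (λ q → h q (r q) (c q)) * G′ N)))))
      ≈⟨ cong s (λ x → cong (pi k s) (λ r → cong (pi k s) (λ c → trans (scale (pi k (pi k s)) _ _) (*-congˡ (scale (pi k (pi k s)) _ _))))) ⟩
    ∑ s (λ x → ∑ (pi k s) (λ r → ∑ (pi k s) (λ c → a x * (∏ (λ q → h q (r q) (c q)) * total))))
      ≈⟨ cong s (λ x → trans (cong (pi k s) (λ r → scale (pi k s) _ _)) (scale (pi k s) _ _)) ⟩
    ∑ s (λ x → a x * ∑ (pi k s) (λ r → ∑ (pi k s) (λ c → ∏ (λ q → h q (r q) (c q)) * total)))
      ≈⟨ scaleʳ s _ a ⟩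
    ∑ s a * ∑ (pi k s) (λ r → ∑ (pi k s) (λ c → ∏ (λ q → h q (r q) (c q)) * total))
      ≈⟨ *-congˡ (trans (cong (pi k s) (λ r → scaleʳ (pi k s) total _)) (scaleʳ (pi k s) total _)) ⟩
    ∑ s a * (∑ (pi k s) (λ r → ∑ (pi k s) (λ c → ∏ (λ q → h q (r q) (c q)))) * total)
      ≈⟨ *-assoc _ _ _ ⟨
    ∑ s a * ∑ (pi k s) (λ r → ∑ (pi k s) (λ c → ∏ (λ q → h q (r q) (c q)))) * total
      ≈⟨ *-congʳ (*-congˡ (trans (cong (pi k s) (λ r → ∑-∏ k s (λ q → h q (r q)))) (∑-∏ k s (λ q x → ∑ s (h q x))))) ⟩
    ∑ s a * ∏ (λ q → ∑ s (λ x → ∑ s (h q x))) * total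
      ≈⟨ *-congˡ (∑-∏-pairs s k (λ p q → θ (suc p) (suc q))) ⟩
    _ ∎
    where
    G : (Fin (suc k) → Fin (suc k) → A) → Carrier
    G N = ∏ (λ p → ∏ (λ q → θ p q (N p q) (N q p)))
    G-ext : Extensional₂ G
    G-ext eq = ∏-cong (λ p → ∏-cong (λ q → reflexive (≡.cong₂ (θ p q) (eq p q) (eq q p))))
    G′ : (Fin k → Fin k → A) → Carrier
    G′ N = ∏ (λ p → ∏ (λ q → θ (suc p) (suc q) (N p q) (N q p)))
    total = ∑ (pi k (pi k s)) G′
    a : A → Carrier
    a x = θ zero zero x x
    h : Fin k → A → A → Carrier
    h q x y = θ zero (suc q) x y * θ (suc q) zero y x
    split : ∀ x r c N → G ((x ∷ r) ∷ (λ p → c p ∷ N p)) ≈ a x * (∏ (λ q → h q (r q) (c q)) * G′ N)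
    split x r c N = begin
      a x * ∏ (λ q → θ zero (suc q) (r q) (c q)) * ∏ (λ p → θ (suc p) zero (c p) (r p) * ∏ (λ q → θ (suc p) (suc q) (N p q) (N q p)))
        ≈⟨ *-congˡ (∏-distrib-* (λ p → θ (suc p) zero (c p) (r p)) _) ⟩
      a x * ∏ (λ q → θ zero (suc q) (r q) (c q)) * (∏ (λ p → θ (suc p) zero (c p) (r p)) * G′ N)
        ≈⟨ solve 4 (λ a b c d → a :* b :* (c :* d) := a :* ((b :* c) :* d)) refl _ _ _ _ ⟩
      a x * (∏ (λ q → θ zero (suc q) (r q) (c q)) * ∏ (λ p → θ (suc p) zero (c p) (r p)) * G′ N)
        ≈⟨ *-congˡ (*-congʳ (∏-distrib-* (λ q → θ zero (suc q) (r q) (c q)) _)) ⟨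
      a x * (∏ (λ q → h q (r q) (c q)) * G′ N) ∎

-- The sum over row sets

<⇒<ᵇ≡true : ∀ {m n} → m ℕ.< n → (m <ᵇ n) ≡ true
<⇒<ᵇ≡true {zero}  (s≤s _)   = ≡.refl
<⇒<ᵇ≡true {suc m} (s≤s m<n) = <⇒<ᵇ≡true m<n

≤⇒<ᵇ≡false : ∀ {m n} → n ℕ.≤ m → (m <ᵇ n) ≡ false
≤⇒<ᵇ≡false {m}     z≤n       = ≡.refl
≤⇒<ᵇ≡false {suc m} (s≤s n≤m) = ≤⇒<ᵇ≡false n≤m

module RowSets (R : CommutativeRing 0ℓ 0ℓ) (w z : CommutativeRing.Carrier R) where
  open CommutativeRing R hiding (zero)
  open SetoidReasoning setoid
  open SemiringSolver commutativeSemiring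
  open Enumeration R
  open Summation

  sign : Carrier → Bool → Carrier
  sign x true  = x
  sign x false = - 1#

  factor : Bool → Carrier → Carrier
  factor b u = if b then 1# + u else 1#

  -- The index p stands for the element p + 1 of [k], so the test says 2 (p + 1) ≤ k. The same shift
  -- is made in `pairFactor`.
  diagFactor : ℕ → ℕ → Bool → Carrier
  diagFactor k p b = factor ((suc (p ℕ.+ p) <ᵇ k) ∧ b) z

  pairFactor : ℕ → ℕ → ℕ → Bool → Bool → Carrier
  pairFactor k p q b c = factor ((suc (p ℕ.+ q) <ᵇ k) ∧ (b ∧ c)) w

  weight : ∀ k → Carrier → (Fin k → Bool) → Carrier
  weight k x B = ∏ (λ p → sign x (B p)) *
    triangleProd k (λ p → diagFactor k (toℕ p) (B p)) (λ p q → pairFactor k (toℕ p) (toℕ q) (B p) (B q))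

  rowSetSum : ℕ → Carrier → Carrier
  rowSetSum k x = ∑ (pi k bool) (weight k x)

  weight-ext : ∀ k x {B B′ : Fin k → Bool} → (∀ i → B i ≡ B′ i) → weight k x B ≈ weight k x B′
  weight-ext k x eq = *-cong (∏-cong (λ p → reflexive (≡.cong (sign x) (eq p))))
    (triangleProd-cong k (λ p → reflexive (≡.cong (diagFactor k (toℕ p)) (eq p)))
                         (λ p q _ → reflexive (≡.cong₂ (pairFactor k (toℕ p) (toℕ q)) (eq p) (eq q))))

  ∏-snoc : ∀ {A : Set} k (h : ℕ → A → Carrier) (g : Fin k → A) c →
           ∏ (λ i → h (toℕ i) (snoc g c i)) ≈ ∏ (λ i → h (toℕ i) (g i)) * h k c
  ∏-snoc k h g c = trans (∏-init-last (λ i → h (toℕ i) (snoc g c i)))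
    (*-cong (∏-cong (λ i → reflexive (≡.cong₂ h (Finₚ.toℕ-inject₁ i) (snoc-inject₁ g c i))))
            (reflexive (≡.cong₂ h (Finₚ.toℕ-fromℕ k) (snoc-last k g c))))

  -- If the first index is chosen, each chosen inner index gains the factor 1 + w from its pair with
  -- it; this is the same as a change of the weight x.
  rescale : Carrier → Bool → Carrier
  rescale x true  = x * (1# + w)
  rescale x false = x

  sign-rescale : ∀ x b c → sign x c * factor (b ∧ c) w ≈ sign (rescale x b) c
  sign-rescale x true  true  = refl
  sign-rescale x true  false = *-identityʳ _
  sign-rescale x false true  = *-identityʳ _
  sign-rescale x false false = *-identityʳ _

  -- Removing both ends lowers each inner index by one and the bound by two, so the tests for the
  -- inner pairs turn into those of `weight k`.
  weight-peel : ∀ k x b (g : Fin k → Bool) c →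
    weight (2 ℕ.+ k) x (b ∷ snoc g c) ≈ sign x c * (sign x b * factor b z * weight k (rescale x b) g)
  weight-peel k x b g c = begin
    sign x b * ∏ (λ i → sign x (snoc g c i)) *
      (factor b z * ∏ (λ q → pairFactor (2 ℕ.+ k) 0 (suc (toℕ q)) b (snoc g c q)) *
        triangleProd (suc k) D O)
      ≈⟨ *-cong (*-congˡ (∏-snoc k (λ _ → sign x) g c))
                (*-cong (*-congˡ (trans (∏-snoc k (λ q → pairFactor (2 ℕ.+ k) 0 (suc q) b) g c)
                                        (trans (*-cong (∏-cong first-pair) last-pair) (*-identityʳ _))))
                        inner) ⟩
    sign x b * (∏ (λ i → sign x (g i)) * sign x c) *
      (factor b z * ∏ (λ q → factor (b ∧ g q) w) * tri)
      ≈⟨ solve 6 (λ a b c d e f → a :* (b :* c) :* (d :* e :* f) := c :* (a :* d :* ((b :* e) :* f))) refl _ _ _ _ _ _ ⟩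
    sign x c * (sign x b * factor b z * (∏ (λ i → sign x (g i)) * ∏ (λ q → factor (b ∧ g q) w) * tri))
      ≈⟨ *-congˡ (*-congˡ (*-congʳ (trans (sym (∏-distrib-* (λ i → sign x (g i)) _)) (∏-cong (λ q → sign-rescale x b (g q)))))) ⟩
    sign x c * (sign x b * factor b z * weight k (rescale x b) g) ∎
    where
    B : Fin (suc k) → Bool
    B = snoc g c
    D : Fin (suc k) → Carrier
    D p = diagFactor (2 ℕ.+ k) (suc (toℕ p)) (B p)
    O : Fin (suc k) → Fin (suc k) → Carrier
    O p q = pairFactor (2 ℕ.+ k) (suc (toℕ p)) (suc (toℕ q)) (B p) (B q)
    tri = triangleProd k (λ p → diagFactor k (toℕ p) (g p)) (λ p q → pairFactor k (toℕ p) (toℕ q) (g p) (g q))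
    factor-false : ∀ {a} b u → a ≡ false → factor (a ∧ b) u ≈ 1#
    factor-false b u ≡.refl = refl
    first-pair : ∀ q → pairFactor (2 ℕ.+ k) 0 (suc (toℕ q)) b (g q) ≈ factor (b ∧ g q) w
    first-pair q = reflexive (≡.cong (λ a → factor (a ∧ (b ∧ g q)) w) (<⇒<ᵇ≡true (Finₚ.toℕ<n q)))
    last-pair : pairFactor (2 ℕ.+ k) 0 (suc k) b c ≈ 1#
    last-pair = factor-false (b ∧ c) w (≤⇒<ᵇ≡false {k} ℕₚ.≤-refl)
    shift : ∀ p q → (suc (p ℕ.+ suc q) <ᵇ suc k) ≡ (suc (p ℕ.+ q) <ᵇ k)
    shift p q = ≡.cong (_<ᵇ k) (ℕₚ.+-suc p q)
    beyond : ∀ p q → q ≡ k → (suc (p ℕ.+ suc q) <ᵇ suc k) ≡ false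
    beyond p q ≡.refl = ≤⇒<ᵇ≡false (ℕₚ.≤-trans (ℕₚ.n≤1+n k) (ℕₚ.m≤n+m (suc k) p))
    inner : triangleProd (suc k) D O ≈ tri
    inner = trans
      (triangleProd-init k D O
        (factor-false (B (fromℕ k)) z (beyond _ _ (Finₚ.toℕ-fromℕ k)))
        (λ p → factor-false (B p ∧ B (fromℕ k)) w (beyond _ _ (Finₚ.toℕ-fromℕ k))))
      (triangleProd-cong k
        (λ p → reflexive (≡.cong₂ (λ a b → factor (a ∧ b) z)
          (≡.trans (≡.cong (λ a → suc (a ℕ.+ suc a) <ᵇ suc k) (Finₚ.toℕ-inject₁ p)) (shift (toℕ p) (toℕ p)))
          (snoc-inject₁ g c p)))
        (λ p q _ → reflexive (≡.cong₂ (λ a b → factor (a ∧ b) w)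
          (≡.trans (≡.cong₂ (λ a b → suc (a ℕ.+ suc b) <ᵇ suc k) (Finₚ.toℕ-inject₁ p) (Finₚ.toℕ-inject₁ q)) (shift (toℕ p) (toℕ q)))
          (≡.cong₂ _∧_ (snoc-inject₁ g c p) (snoc-inject₁ g c q)))))

  rowSetSum-0 : ∀ x → rowSetSum 0 x ≈ 1#
  rowSetSum-0 x = *-identityˡ _

  rowSetSum-1 : ∀ x → rowSetSum 1 x ≈ x + - 1#
  rowSetSum-1 x = solve 2 (λ x m → m :* con 1 :* (con 1 :* con 1 :* con 1) :+ x :* con 1 :* (con 1 :* con 1 :* con 1) := x :+ m) refl x (- 1#)

  -- Of the indices 0,…,k+1 the last one pairs with none, and 0 pairs with all of the remaining ones.
  rowSetSum-2+ : ∀ k x → rowSetSum (2 ℕ.+ k) x ≈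
    (x + - 1#) * (x * (1# + z) * rowSetSum k (x * (1# + w)) + - 1# * rowSetSum k x)
  rowSetSum-2+ k x = begin
    ∑ bool (λ b → ∑ (pi (suc k) bool) (λ h → weight (2 ℕ.+ k) x (b ∷ h)))
      ≈⟨ cong bool (λ b → ∑-snoc k bool {λ h → weight (2 ℕ.+ k) x (b ∷ h)} (λ eq → weight-ext (2 ℕ.+ k) x (∷-cong {_~_ = _≡_} ≡.refl eq))) ⟩
    ∑ bool (λ b → ∑ bool (λ c → ∑ (pi k bool) (λ g → weight (2 ℕ.+ k) x (b ∷ snoc g c))))
      ≈⟨ cong bool (λ b → cong bool (λ c → trans (cong (pi k bool) (λ g → weight-peel k x b g c))
           (trans (scale (pi k bool) _ _) (*-congˡ (scale (pi k bool) _ (weight k (rescale x b))))))) ⟩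
    ∑ bool (λ b → ∑ bool (λ c → sign x c * (sign x b * factor b z * rowSetSum k (rescale x b))))
      ≈⟨ solve 5 (λ x m z f g → (m :* (m :* con 1 :* f) :+ x :* (m :* con 1 :* f)) :+ (m :* (x :* z :* g) :+ x :* (x :* z :* g))
           := (x :+ m) :* (x :* z :* g :+ m :* f)) refl x (- 1#) (1# + z) _ _ ⟩
    (x + - 1#) * (x * (1# + z) * rowSetSum k (x * (1# + w)) + - 1# * rowSetSum k x) ∎

-- Membership in S⁺ after numbering the columns from the right

T-ext : ∀ {a b} → (T a → T b) → (T b → T a) → a ≡ b
T-ext {true}  {true}  f g = ≡.refl
T-ext {true}  {false} f g with () ← f tt
T-ext {false} {true}  f g with () ← g tt
T-ext {false} {false} f g = ≡.refl

T-∧⁺ : ∀ {a b} → T a → T b → T (a ∧ b)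
T-∧⁺ p q = Equivalence.from T-∧ (p , q)

T-∧⁻ : ∀ {a b} → T (a ∧ b) → T a × T b
T-∧⁻ = Equivalence.to T-∧

T-⇒⁺ : ∀ {a b} → (T a → T b) → T (not a ∨ b)
T-⇒⁺ {true}  f = f tt
T-⇒⁺ {false} f = tt

T-⇒⁻ : ∀ {a b} → T (not a ∨ b) → T a → T b
T-⇒⁻ {true} p _ = p

beq⇒≡ : ∀ {a b} → T (beq a b) → a ≡ b
beq⇒≡ {true}  {true}  _ = ≡.refl
beq⇒≡ {false} {false} _ = ≡.refl

≡⇒beq : ∀ {a b} → a ≡ b → T (beq a b)
≡⇒beq {true}  ≡.refl = tt
≡⇒beq {false} ≡.refl = tt

all⁺ : ∀ {n} {p : Fin n → Bool} → (∀ i → T (p i)) → T (all p (allFin n))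
all⁺ f = Allₚ.all⁻ _ (Allₚ.tabulate⁺ f)

all⁻ : ∀ {n} {p : Fin n → Bool} → T (all p (allFin n)) → ∀ i → T (p i)
all⁻ t = Allₚ.tabulate⁻ (Allₚ.all⁺ _ _ t)

any⁺ : ∀ {n} {p : Fin n → Bool} i → T (p i) → T (any p (allFin n))
any⁺ i t = Anyₚ.any⁺ _ (Anyₚ.tabulate⁺ i t)

any⁻ : ∀ {n} {p : Fin n → Bool} → T (any p (allFin n)) → ∃ λ i → T (p i)
any⁻ t = Anyₚ.tabulate⁻ (Anyₚ.any⁻ _ _ t)

allCells⁺ : ∀ {k} {p : Fin k → Fin k → Bool} → (∀ i j → T (p i j)) → T (allCells p)
allCells⁺ f = all⁺ (λ i → all⁺ (f i))

allCells⁻ : ∀ {k} {p : Fin k → Fin k → Bool} → T (allCells p) → ∀ i j → T (p i j)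
allCells⁻ t i = all⁻ (all⁻ t i)

-- The additive form lets the translations below proceed by cancellation in ℕ.
toℕ-opposite : ∀ {k} (q : Fin k) → toℕ (opposite q) ℕ.+ suc (toℕ q) ≡ k
toℕ-opposite q = ≡.trans (≡.cong (ℕ._+ suc (toℕ q)) (Finₚ.opposite-prop q)) (ℕₚ.m∸n+n≡m (Finₚ.toℕ<n q))

module _ {k} (p q : Fin k) where
  private
    r = toℕ (opposite q)
    r+q = toℕ-opposite q

  opposite-≤ᵇ : (toℕ p ≤ᵇ r) ≡ (toℕ p ℕ.+ toℕ q <ᵇ k)
  opposite-≤ᵇ = T-ext
    (λ t → ℕₚ.<⇒<ᵇ (≡.subst (toℕ p ℕ.+ toℕ q ℕ.<_) r+q
      (≡.subst (toℕ p ℕ.+ toℕ q ℕ.<_) (≡.sym (ℕₚ.+-suc r (toℕ q))) (s≤s (ℕₚ.+-monoˡ-≤ (toℕ q) (ℕₚ.≤ᵇ⇒≤ _ _ t))))))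
    (λ t → ℕₚ.≤⇒≤ᵇ (ℕₚ.+-cancelʳ-≤ (toℕ q) (toℕ p) r (ℕₚ.≤-pred
      (≡.subst (suc (toℕ p ℕ.+ toℕ q) ℕ.≤_) (≡.trans (≡.sym r+q) (ℕₚ.+-suc r (toℕ q))) (ℕₚ.<ᵇ⇒< _ _ t)))))

  opposite-isLastCol : isLastCol (opposite q) ≡ (toℕ q ≡ᵇ 0)
  opposite-isLastCol = T-ext
    (λ t → ℕₚ.≡⇒≡ᵇ _ 0 (ℕₚ.m+n≡0⇒n≡0 0 (ℕₚ.suc-injective (ℕₚ.+-cancelˡ-≡ r _ _
      (≡.trans r+q (≡.trans (≡.sym (ℕₚ.≡ᵇ⇒≡ (suc r) k t)) (≡.sym (ℕₚ.+-comm r 1))))))))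
    (λ t → ℕₚ.≡⇒≡ᵇ (suc r) k (≡.trans (≡.sym (ℕₚ.+-comm r 1))
      (≡.trans (≡.cong (λ a → r ℕ.+ suc a) (≡.sym (ℕₚ.≡ᵇ⇒≡ (toℕ q) 0 t))) r+q)))

  opposite-isSE : isSE p (opposite q) ≡ (toℕ q <ᵇ toℕ p)
  opposite-isSE = T-ext
    (λ t → ℕₚ.<⇒<ᵇ (ℕₚ.+-cancelˡ-≤ r _ _ (≡.subst₂ ℕ._≤_ (≡.sym r+q) (ℕₚ.+-comm (toℕ p) r) (ℕₚ.≤ᵇ⇒≤ _ _ t))))
    (λ t → ℕₚ.≤⇒≤ᵇ (≡.subst₂ ℕ._≤_ r+q (ℕₚ.+-comm r (toℕ p)) (ℕₚ.+-monoʳ-≤ r (ℕₚ.<ᵇ⇒< (toℕ q) (toℕ p) t))))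

  opposite-isDiag : isDiag p (opposite q) ≡ (toℕ p ≡ᵇ toℕ q)
  opposite-isDiag = T-ext
    (λ t → ℕₚ.≡⇒≡ᵇ _ _ (ℕₚ.+-cancelˡ-≡ r _ _ (ℕₚ.suc-injective
      (≡.trans (≡.cong suc (ℕₚ.+-comm r (toℕ p))) (≡.trans (ℕₚ.≡ᵇ⇒≡ (suc (toℕ p ℕ.+ r)) k t) (≡.trans (≡.sym r+q) (ℕₚ.+-suc r (toℕ q))))))))
    (λ t → ℕₚ.≡⇒≡ᵇ (suc (toℕ p ℕ.+ r)) k (≡.trans (≡.cong suc (≡.trans (≡.cong (ℕ._+ r) (ℕₚ.≡ᵇ⇒≡ (toℕ p) (toℕ q) t)) (ℕₚ.+-comm (toℕ q) r)))
      (≡.trans (≡.sym (ℕₚ.+-suc r (toℕ q))) r+q)))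

-- The condition on the entry x at (p, q) and the entry y at (q, p) once the columns are numbered from the right:
-- duality becomes symmetry, upper triangularity becomes p + q < k, and the corner becomes (0, 0).
admissible : ℕ → ℕ → ℕ → Bool → Bool → Bool
admissible k p q x y = beq x y ∧ ((not x ∨ (p ℕ.+ q <ᵇ k)) ∧ (not ((p ≡ᵇ 0) ∧ (q ≡ᵇ 0)) ∨ x))

flip : ∀ {k} → PMat k → PMat k
flip M p q = M p (opposite q)

module _ {k} (M : PMat (suc k)) where
  private
    K = suc k
    opp² = Finₚ.opposite-involutive
    cells = allCells (λ p q → admissible K (toℕ p) (toℕ q) (flip M p q) (flip M q p))

  inSPlus⇒admissible : T (inSPlus M) → ∀ p q → T (admissible K (toℕ p) (toℕ q) (flip M p q) (flip M q p))
  inSPlus⇒admissible t p q with T-∧⁻ {isFishburn M} t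
  ... | fishburn , t′ with T-∧⁻ {upperTri M} fishburn | T-∧⁻ {isSelfDual M} t′
  ... | upper , _ | dual , corner = T-∧⁺ (≡⇒beq symmetric) (T-∧⁺ triangular (T-⇒⁺ cornered))
    where
    symmetric : flip M p q ≡ flip M q p
    symmetric = ≡.trans (beq⇒≡ (allCells⁻ dual p (opposite q))) (≡.cong (λ a → M a (opposite p)) (opp² q))
    triangular : T (not (flip M p q) ∨ (toℕ p ℕ.+ toℕ q <ᵇ K))
    triangular = T-⇒⁺ (λ m → ≡.subst T (opposite-≤ᵇ p q) (T-⇒⁻ (allCells⁻ upper p (opposite q)) m))
    at-corner : ∀ i j → T (isCorner i j ∧ M i j) → T (M zero (fromℕ k))
    at-corner i j c with T-∧⁻ {isCorner i j} c
    ... | ij , m with T-∧⁻ {toℕ i ≡ᵇ 0} ij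
    ... | i0 , jl = ≡.subst₂ (λ a b → T (M a b)) (Finₚ.toℕ-injective (ℕₚ.≡ᵇ⇒≡ (toℕ i) 0 i0))
      (Finₚ.toℕ-injective (≡.trans (ℕₚ.≡ᵇ⇒≡ (toℕ j) k jl) (≡.sym (Finₚ.toℕ-fromℕ k)))) m
    cornered : T ((toℕ p ≡ᵇ 0) ∧ (toℕ q ≡ᵇ 0)) → T (flip M p q)
    cornered pq with T-∧⁻ {toℕ p ≡ᵇ 0} pq | any⁻ corner
    ... | p0 , q0 | i , ci with any⁻ ci
    ... | j , cj = ≡.subst₂ (λ a b → T (flip M a b))
      (Finₚ.toℕ-injective (≡.sym (ℕₚ.≡ᵇ⇒≡ (toℕ p) 0 p0))) (Finₚ.toℕ-injective (≡.sym (ℕₚ.≡ᵇ⇒≡ (toℕ q) 0 q0))) (at-corner i j cj)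

  admissible⇒inSPlus : (∀ p q → T (admissible K (toℕ p) (toℕ q) (flip M p q) (flip M q p))) →
                       T (rowsNonzero M) → T (inSPlus M)
  admissible⇒inSPlus ok rows = T-∧⁺ {isFishburn M} (T-∧⁺ {upperTri M} (allCells⁺ upper) (T-∧⁺ rows (all⁺ column)))
    (T-∧⁺ {isSelfDual M} (allCells⁺ (λ i j → ≡⇒beq (dual i j)))
      corner)
    where
    corner : T (cornerOne M)
    corner = any⁺ {p = λ i → any (λ j → isCorner i j ∧ M i j) (allFin K)} zero
      (any⁺ {p = λ j → isCorner {K} zero j ∧ M zero j} (fromℕ k)
        (T-∧⁺ (ℕₚ.≡⇒≡ᵇ _ _ (Finₚ.toℕ-fromℕ k))
              (proj₂ (T-∧⁻ {not (flip M zero zero) ∨ true}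
                (proj₂ (T-∧⁻ {beq (flip M zero zero) (flip M zero zero)} (ok zero zero)))))))
    dual : ∀ i j → M i j ≡ M (opposite j) (opposite i)
    dual i j = ≡.trans (≡.cong (M i) (≡.sym (opp² j)))
      (beq⇒≡ (proj₁ (T-∧⁻ {beq (flip M i (opposite j)) (flip M (opposite j) i)} (ok i (opposite j)))))
    upper : ∀ i j → T (not (M i j) ∨ (toℕ i ≤ᵇ toℕ j))
    upper i j = ≡.subst (λ a → T (not (M i a) ∨ (toℕ i ≤ᵇ toℕ a))) (opp² j) (T-⇒⁺ (λ m →
      ≡.subst T (≡.sym (opposite-≤ᵇ i (opposite j)))
        (T-⇒⁻ (proj₁ (T-∧⁻ (proj₂ (T-∧⁻ {beq (flip M i (opposite j)) (flip M (opposite j) i)} (ok i (opposite j)))))) m)))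
    column : ∀ j → T (any (λ i → M i j) (allFin K))
    -- Duality carries a nonzero entry at (`opposite j`, l) to (`opposite l`, j).
    column j with any⁻ (all⁻ rows (opposite j))
    ... | l , m = any⁺ (opposite l) (≡.subst T (≡.trans (dual (opposite j) l) (≡.cong (M (opposite l)) (opp² j))) m)

  -- Separates what can be tested on a cell and its mirror image from the row condition, which
  -- couples a whole row.
  inSPlus≡ : inSPlus M ≡ allCells (λ p q → admissible K (toℕ p) (toℕ q) (flip M p q) (flip M q p)) ∧ rowsNonzero M
  inSPlus≡ = T-ext
    (λ t → T-∧⁺ {cells} (allCells⁺ (inSPlus⇒admissible t))
      (proj₁ (T-∧⁻ {rowsNonzero M} (proj₂ (T-∧⁻ {upperTri M} (proj₁ (T-∧⁻ {isFishburn M} t)))))))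
    (λ t → admissible⇒inSPlus (allCells⁻ (proj₁ (T-∧⁻ {cells} t))) (proj₂ (T-∧⁻ {cells} t)))

-- The sum over matrices

<⇒≡ᵇ≡false : ∀ {m n} → m ℕ.< n → (m ≡ᵇ n) ≡ false
<⇒≡ᵇ≡false {zero}  (s≤s _)   = ≡.refl
<⇒≡ᵇ≡false {suc m} (s≤s m<n) = <⇒≡ᵇ≡false m<n

>⇒≡ᵇ≡false : ∀ {m n} → n ℕ.< m → (m ≡ᵇ n) ≡ false
>⇒≡ᵇ≡false {n = zero}  (s≤s _)   = ≡.refl
>⇒≡ᵇ≡false {n = suc n} (s≤s n<m) = >⇒≡ᵇ≡false n<m

≡ᵇ-refl : ∀ n → (n ≡ᵇ n) ≡ true
≡ᵇ-refl zero    = ≡.refl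
≡ᵇ-refl (suc n) = ≡ᵇ-refl n

module Brackets (R : CommutativeRing 0ℓ 0ℓ) where
  open CommutativeRing R hiding (zero)
  open SetoidReasoning setoid
  open Enumeration R
  open Exp commutativeSemiring using (_^_; ^-homo-*)
  open RingProperties ring using (-0#≈0#)

  ⟦_⟧ : Bool → Carrier
  ⟦ true ⟧  = 1#
  ⟦ false ⟧ = 0#

  ⟦∧⟧ : ∀ a b → ⟦ a ∧ b ⟧ ≈ ⟦ a ⟧ * ⟦ b ⟧
  ⟦∧⟧ true  b = sym (*-identityˡ _)
  ⟦∧⟧ false b = sym (zeroˡ _)

  ⟦all⟧ : ∀ {A : Set} n (p : A → Bool) (f : Fin n → A) → ⟦ all p (tabulate f) ⟧ ≈ ∏ (λ i → ⟦ p (f i) ⟧)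
  ⟦all⟧ zero    p f = refl
  ⟦all⟧ (suc n) p f = trans (⟦∧⟧ (p (f zero)) _) (*-congˡ (⟦all⟧ n p (f ∘ suc)))

  -- The negated product comes first because `bool` adds the value at `false`, where the sign is -
  -- 1#, before the value at `true`.
  ⟦any⟧ : ∀ {A : Set} n (p : A → Bool) (f : Fin n → A) →
          ⟦ any p (tabulate f) ⟧ ≈ - ∏ (λ i → ⟦ not (p (f i)) ⟧) + 1#
  ⟦any⟧ zero    p f = sym (-‿inverseˡ 1#)
  ⟦any⟧ (suc n) p f with p (f zero)
  ... | true  = sym (trans (+-congʳ (trans (-‿cong (zeroˡ _)) -0#≈0#)) (+-identityˡ _))
  ... | false = trans (⟦any⟧ n p (f ∘ suc)) (+-congʳ (-‿cong (sym (*-identityˡ _))))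

  ⟦allCells⟧ : ∀ {k} (p : Fin k → Fin k → Bool) → ⟦ allCells p ⟧ ≈ ∏ (λ i → ∏ (λ j → ⟦ p i j ⟧))
  ⟦allCells⟧ {k} p = trans (⟦all⟧ k _ id) (∏-cong (λ i → ⟦all⟧ k (p i) id))

  ^-sumℕ : ∀ {A : Set} u n (h : A → ℕ) (f : Fin n → A) → u ^ sumℕ (map h (tabulate f)) ≈ ∏ (λ i → u ^ h (f i))
  ^-sumℕ u zero    h f = refl
  ^-sumℕ u (suc n) h f = trans (^-homo-* u (h (f zero)) _) (*-congˡ (^-sumℕ u n h (f ∘ suc)))

  ^-sumCells : ∀ {k} u (h : Fin k → Fin k → ℕ) → u ^ sumCells h ≈ ∏ (λ i → ∏ (λ j → u ^ h i j))
  ^-sumCells {k} u h = trans (^-sumℕ u k _ id) (∏-cong (λ i → ^-sumℕ u k (h i) id))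

  ∏-opposite : ∀ {k} (h : Fin k → Carrier) → ∏ h ≈ ∏ (λ q → h (opposite q))
  ∏-opposite h = ∏-permute h Perm.reverse

module MatrixSum (R : CommutativeRing 0ℓ 0ℓ) (v w z : CommutativeRing.Carrier R) where
  open CommutativeRing R hiding (zero)
  open SetoidReasoning setoid
  open SemiringSolver commutativeSemiring using (solve; _:=_; _:+_; _:*_; con)
  open Enumeration R
  open Summation
  open Exp commutativeSemiring using (_^_)
  open Brackets R
  open RowSets R w z
  open RingProperties ring using (-1*x≈-x)

  monomial : ∀ {k} → PMat k → Carrier
  monomial M = v ^ statMax M * (w ^ statSe M * (z ^ statDg M * ⟦ inSPlus M ⟧))

  countIf : Bool → Bool → ℕ
  countIf a x = if a then b2n x else 0

  isMaxᵇ isSeᵇ isDgᵇ : ℕ → ℕ → Bool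
  isMaxᵇ p q = (q ≡ᵇ 0) ∧ not ((p ≡ᵇ 0) ∧ (q ≡ᵇ 0))
  isSeᵇ p q = (q <ᵇ p) ∧ not (q ≡ᵇ 0)
  isDgᵇ p q = (p ≡ᵇ q) ∧ not ((p ≡ᵇ 0) ∧ (q ≡ᵇ 0))

  statFactor : ℕ → ℕ → Bool → Carrier
  statFactor p q x = v ^ countIf (isMaxᵇ p q) x * (w ^ countIf (isSeᵇ p q) x * z ^ countIf (isDgᵇ p q) x)

  cellWeight : ℕ → ℕ → ℕ → Bool → Bool → Carrier
  cellWeight k p q x y = statFactor p q x * ⟦ admissible k p q x y ⟧

  ∏² : ∀ {k} → (Fin k → Fin k → Carrier) → Carrier
  ∏² h = ∏ (λ p → ∏ (λ q → h p q))

  ∏²-cong : ∀ {k} {h h′ : Fin k → Fin k → Carrier} → (∀ p q → h p q ≈ h′ p q) → ∏² h ≈ ∏² h′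
  ∏²-cong eq = ∏-cong (λ p → ∏-cong (eq p))

  ∏²-distrib-* : ∀ {k} (h h′ : Fin k → Fin k → Carrier) → ∏² (λ p q → h p q * h′ p q) ≈ ∏² h * ∏² h′
  ∏²-distrib-* h h′ = trans (∏-cong (λ p → ∏-distrib-* (h p) (h′ p))) (∏-distrib-* (λ p → ∏ (h p)) (λ p → ∏ (h′ p)))

  someInRow : ∀ {k} → PMat k → Carrier
  someInRow N = ∏ (λ p → - ∏ (λ q → ⟦ not (N p q) ⟧) + 1#)

  ^-flip : ∀ {k} u (h : Fin k → Fin k → Bool) (h′ : ℕ → ℕ → Bool) (M : PMat k) →
           (∀ p q → h p (opposite q) ≡ h′ (toℕ p) (toℕ q)) →
           u ^ sumCells (λ i j → countIf (h i j) (M i j)) ≈ ∏² (λ p q → u ^ countIf (h′ (toℕ p) (toℕ q)) (flip M p q))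
  ^-flip {k} u h h′ M eq = trans (^-sumCells {k} u (λ i j → countIf (h i j) (M i j)))
    (∏-cong (λ p → trans (∏-opposite (λ j → u ^ countIf (h p j) (M p j)))
      (∏-cong (λ q → reflexive (≡.cong (λ a → u ^ countIf a (flip M p q)) (eq p q))))))

  ⟦rowsNonzero⟧ : ∀ {k} (M : PMat k) → ⟦ rowsNonzero M ⟧ ≈ someInRow (flip M)
  ⟦rowsNonzero⟧ {k} M = trans (⟦all⟧ k (λ i → any (M i) (allFin k)) id)
    (∏-cong (λ p → trans (⟦any⟧ k (M p) id) (+-congʳ (-‿cong (∏-opposite (λ q → ⟦ not (M p q) ⟧))))))

  stats-flip : ∀ {k} (M : PMat k) →
    v ^ statMax M * (w ^ statSe M * z ^ statDg M) ≈ ∏² (λ p q → statFactor (toℕ p) (toℕ q) (flip M p q))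
  stats-flip {k} M = trans
    (*-cong
      (^-flip v (λ i j → isLastCol j ∧ not (isCorner i j)) isMaxᵇ M
        (λ p q → ≡.cong (λ a → a ∧ not ((toℕ p ≡ᵇ 0) ∧ a)) (opposite-isLastCol p q)))
      (*-cong
        (^-flip w (λ i j → isSE i j ∧ not (isLastCol j)) isSeᵇ M
          (λ p q → ≡.cong₂ (λ a b → a ∧ not b) (opposite-isSE p q) (opposite-isLastCol p q)))
        (^-flip z (λ i j → isDiag i j ∧ not (isCorner i j)) isDgᵇ M
          (λ p q → ≡.cong₂ (λ a b → a ∧ not ((toℕ p ≡ᵇ 0) ∧ b)) (opposite-isDiag p q) (opposite-isLastCol p q)))))
    (sym (trans (∏²-distrib-* a (λ p q → b p q * c p q)) (*-congˡ (∏²-distrib-* b c))))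
    where
    a b c : Fin k → Fin k → Carrier
    a p q = v ^ countIf (isMaxᵇ (toℕ p) (toℕ q)) (flip M p q)
    b p q = w ^ countIf (isSeᵇ (toℕ p) (toℕ q)) (flip M p q)
    c p q = z ^ countIf (isDgᵇ (toℕ p) (toℕ q)) (flip M p q)

  cellProd : ∀ {k} → PMat k → Carrier
  cellProd {k} N = ∏² (λ p q → cellWeight k (toℕ p) (toℕ q) (N p q) (N q p))

  monomial-flip : ∀ {k} (M : PMat (suc k)) → monomial M ≈ cellProd (flip M) * someInRow (flip M)
  monomial-flip {k} M = begin
    v ^ statMax M * (w ^ statSe M * (z ^ statDg M * ⟦ inSPlus M ⟧))
      ≈⟨ solve 4 (λ a b c d → a :* (b :* (c :* d)) := a :* (b :* c) :* d) refl (v ^ statMax M) (w ^ statSe M) (z ^ statDg M) ⟦ inSPlus M ⟧ ⟩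
    v ^ statMax M * (w ^ statSe M * z ^ statDg M) * ⟦ inSPlus M ⟧
      ≈⟨ *-cong (stats-flip M) (trans (reflexive (≡.cong ⟦_⟧ (inSPlus≡ M))) (⟦∧⟧ (allCells ok) (rowsNonzero M))) ⟩
    ∏² stat * (⟦ allCells ok ⟧ * ⟦ rowsNonzero M ⟧)
      ≈⟨ *-congˡ (*-cong (⟦allCells⟧ ok) (⟦rowsNonzero⟧ M)) ⟩
    ∏² stat * (∏² (λ p q → ⟦ ok p q ⟧) * someInRow (flip M))
      ≈⟨ *-assoc _ _ _ ⟨
    ∏² stat * ∏² (λ p q → ⟦ ok p q ⟧) * someInRow (flip M)
      ≈⟨ *-congʳ (∏²-distrib-* stat (λ p q → ⟦ ok p q ⟧)) ⟨
    cellProd (flip M) * someInRow (flip M) ∎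
    where
    stat : Fin (suc k) → Fin (suc k) → Carrier
    stat p q = statFactor (toℕ p) (toℕ q) (flip M p q)
    ok : Fin (suc k) → Fin (suc k) → Bool
    ok p q = admissible (suc k) (toℕ p) (toℕ q) (flip M p q) (flip M q p)

  -- Inclusion–exclusion: B is the set of rows that are allowed to be nonzero.
  someInRow-expand : ∀ {k} (N : PMat k) → someInRow N ≈
    ∑ (pi k bool) (λ B → ∏ (λ p → sign 1# (B p)) * ∏² (λ p q → ⟦ B p ∨ not (N p q) ⟧))
  someInRow-expand {k} N = sym (trans
    (cong (pi k bool) (λ B → sym (∏-distrib-* (λ p → sign 1# (B p)) (λ p → ∏ (λ q → ⟦ B p ∨ not (N p q) ⟧)))))
    (trans (∑-∏ k bool (λ p b → sign 1# b * ∏ (λ q → ⟦ b ∨ not (N p q) ⟧)))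
      (∏-cong {k} (λ p → +-cong (-1*x≈-x (∏ (λ q → ⟦ not (N p q) ⟧))) (trans (*-identityˡ _) (∏-1 k))))))
    where
    ∏-1 : ∀ n → ∏ {n} (λ _ → 1#) ≈ 1#
    ∏-1 zero    = refl
    ∏-1 (suc n) = trans (*-identityˡ _) (∏-1 n)

  -- `b` records whether row p belongs to B; outside B the entry x must be 0.
  pairWeight : ℕ → ℕ → ℕ → Bool → Bool → Bool → Carrier
  pairWeight k p q b x y = cellWeight k p q x y * ⟦ b ∨ not x ⟧

  ^-countIf-false : ∀ u a → u ^ countIf a false ≈ 1#
  ^-countIf-false u true  = refl
  ^-countIf-false u false = refl

  statFactor-false : ∀ p q → statFactor p q false ≈ 1#
  statFactor-false p q = trans (*-cong (^-countIf-false v (isMaxᵇ p q))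
    (*-cong (^-countIf-false w (isSeᵇ p q)) (^-countIf-false z (isDgᵇ p q)))) (trans (*-identityˡ _) (*-identityˡ _))

  -- Such a cell lies on the other side of the anti-diagonal from the SE-cells and, since q > 0,
  -- outside the last column. Its mirror image carries the weight of the pair.
  statFactor-above : ∀ p q → p ℕ.< q → statFactor p q true ≈ 1#
  statFactor-above p (suc q) p<q
    rewrite ≤⇒<ᵇ≡false {suc q} {p} (ℕₚ.<⇒≤ p<q) | <⇒≡ᵇ≡false p<q = trans (*-identityˡ _) (*-identityˡ _)

  -- The weight of a pair p < q of ones, read at (q, p): this cell is in the last column when p = 0,
  -- and otherwise is an SE-cell counted by `statSe`.
  offDiag : ℕ → Carrier
  offDiag zero    = v
  offDiag (suc _) = w

  statFactor-below : ∀ p q → p ℕ.< q → statFactor q p true ≈ offDiag p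
  statFactor-below zero    (suc q) p<q = solve 1 (λ v → v :* con 1 :* (con 1 :* con 1) := v) refl v
  statFactor-below (suc p) (suc q) (s≤s p<q)
    rewrite <⇒<ᵇ≡true p<q | >⇒≡ᵇ≡false p<q = solve 1 (λ w → con 1 :* (w :* con 1 :* con 1) := w) refl w

  statFactor-diag : ∀ p → statFactor (suc p) (suc p) true ≈ z
  statFactor-diag p
    rewrite ≤⇒<ᵇ≡false {p} {p} ℕₚ.≤-refl | ≡ᵇ-refl p = solve 1 (λ z → con 1 :* (con 1 :* (z :* con 1)) := z) refl z

  ⟦⟧-factor : ∀ a b u → 1# + u * ⟦ a ⟧ * ⟦ b ⟧ ≈ factor (a ∧ b) u
  ⟦⟧-factor true  true  u = +-congˡ (trans (*-identityʳ _) (*-identityʳ _))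
  ⟦⟧-factor true  false u = trans (+-congˡ (zeroʳ _)) (+-identityʳ _)
  ⟦⟧-factor false b     u = trans (+-congˡ (trans (*-congʳ (zeroʳ _)) (zeroˡ _))) (+-identityʳ _)

  -- The corner must be 1 and is seen by no statistic, so all that remains is the requirement that
  -- row 0 belong to B. This kills half of the row sets in `rowSetWeight-false`.
  diag-corner : ∀ k b → ∑ bool (λ x → pairWeight (suc k) 0 0 b x x) ≈ ⟦ b ⟧
  diag-corner k true  = solve 0 (con 1 :* (con 1 :* con 1) :* con 0 :* con 1 :+ con 1 :* (con 1 :* con 1) :* con 1 :* con 1 := con 1) refl
  diag-corner k false = solve 0 (con 1 :* (con 1 :* con 1) :* con 0 :* con 1 :+ con 1 :* (con 1 :* con 1) :* con 1 :* con 0 := con 0) refl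

  pairWeight-false : ∀ k p q b → (p ≡ᵇ 0) ∧ (q ≡ᵇ 0) ≡ false → pairWeight k p q b false false ≈ 1#
  pairWeight-false k p q b notCorner = trans
    (*-cong (*-cong (statFactor-false p q) (reflexive (≡.cong (λ a → ⟦ not a ∨ false ⟧) notCorner)))
            (reflexive (≡.cong ⟦_⟧ (∨-zeroʳ b))))
    (trans (*-identityʳ _) (*-identityʳ _))

  pairWeight-true : ∀ k p q b → pairWeight k p q b true true ≈ statFactor p q true * ⟦ p ℕ.+ q <ᵇ k ⟧ * ⟦ b ⟧
  pairWeight-true k p q b = *-cong
    (*-congˡ (reflexive (≡.cong ⟦_⟧ (≡.trans (≡.cong ((p ℕ.+ q <ᵇ k) ∧_) (∨-zeroʳ (not ((p ≡ᵇ 0) ∧ (q ≡ᵇ 0))))) (∧-identityʳ _)))))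
    (reflexive (≡.cong ⟦_⟧ (∨-identityʳ b)))

  diag-inner : ∀ k p b → ∑ bool (λ x → pairWeight k (suc p) (suc p) b x x) ≈ factor ((suc p ℕ.+ suc p <ᵇ k) ∧ b) z
  diag-inner k p b = trans
    (+-cong (pairWeight-false k (suc p) (suc p) b ≡.refl)
            (trans (pairWeight-true k (suc p) (suc p) b) (*-congʳ (*-congʳ (statFactor-diag p)))))
    (⟦⟧-factor (suc p ℕ.+ suc p <ᵇ k) b z)

  pairWeight-asym : ∀ k p q b x → pairWeight k p q b x (not x) ≈ 0#
  pairWeight-asym k p q b true  = trans (*-congʳ (zeroʳ _)) (zeroˡ _)
  pairWeight-asym k p q b false = trans (*-congʳ (zeroʳ _)) (zeroˡ _)

  -- Symmetry kills the two mixed terms. Two zeros give 1; two ones require p + q < k and both rows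
  -- in B.
  off-diag : ∀ k p q b c → p ℕ.< q →
    ∑ bool (λ x → ∑ bool (λ y → pairWeight k p q b x y * pairWeight k q p c y x)) ≈
    factor ((p ℕ.+ q <ᵇ k) ∧ (b ∧ c)) (offDiag p)
  off-diag k p q@(suc _) b c p<q = begin
    (pairWeight k p q b false false * pairWeight k q p c false false + pairWeight k p q b false true * _) +
    (pairWeight k p q b true false * _ + pairWeight k p q b true true * pairWeight k q p c true true)
      ≈⟨ +-cong (+-cong (*-cong (pairWeight-false k p q b pq) (pairWeight-false k q p c ≡.refl))
                        (*-congʳ (pairWeight-asym k p q b false)))
                (+-cong (*-congʳ (pairWeight-asym k p q b true))
                        (*-cong (trans (pairWeight-true k p q b) (*-congʳ (*-congʳ (statFactor-above p q p<q))))
                                (trans (pairWeight-true k q p c)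
                                  (*-congʳ (*-cong (statFactor-below p q p<q) (reflexive (≡.cong (λ a → ⟦ a <ᵇ k ⟧) (ℕₚ.+-comm q p)))))))) ⟩
    (1# * 1# + 0# * _) + (0# * _ + 1# * ⟦ a ⟧ * ⟦ b ⟧ * (offDiag p * ⟦ a ⟧ * ⟦ c ⟧))
      ≈⟨ solve 6 (λ a b c u s t → (con 1 :* con 1 :+ con 0 :* s) :+ (con 0 :* t :+ con 1 :* a :* b :* (u :* a :* c))
                 := con 1 :+ u :* (a :* a) :* (b :* c)) refl ⟦ a ⟧ ⟦ b ⟧ ⟦ c ⟧ (offDiag p) _ _ ⟩
    1# + offDiag p * (⟦ a ⟧ * ⟦ a ⟧) * (⟦ b ⟧ * ⟦ c ⟧)
      -- Both cells of the pair test the same inequality, so its indicator occurs squared.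
      ≈⟨ +-congˡ (*-cong (*-congˡ (idem a)) (sym (⟦∧⟧ b c))) ⟩
    1# + offDiag p * ⟦ a ⟧ * ⟦ b ∧ c ⟧
      ≈⟨ ⟦⟧-factor a (b ∧ c) (offDiag p) ⟩
    factor (a ∧ (b ∧ c)) (offDiag p) ∎
    where
    a = p ℕ.+ q <ᵇ k
    pq : (p ≡ᵇ 0) ∧ false ≡ false
    pq = ∧-zeroʳ (p ≡ᵇ 0)
    idem : ∀ a → ⟦ a ⟧ * ⟦ a ⟧ ≈ ⟦ a ⟧
    idem true  = *-identityˡ _
    idem false = zeroˡ _

  sign-factor : ∀ b u → sign 1# b * factor b u ≈ sign (1# + u) b
  sign-factor true  u = *-identityˡ _
  sign-factor false u = *-identityʳ _

  rowSetWeight : ∀ k → (Fin k → Bool) → Carrier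
  rowSetWeight k B = ∏ (λ p → sign 1# (B p)) * triangleProd k
    (λ p → ∑ bool (λ x → pairWeight k (toℕ p) (toℕ p) (B p) x x))
    (λ p q → ∑ bool (λ x → ∑ bool (λ y →
      pairWeight k (toℕ p) (toℕ q) (B p) x y * pairWeight k (toℕ q) (toℕ p) (B q) y x)))

  rowSetWeight-false : ∀ k g → rowSetWeight (suc k) (false ∷ g) ≈ 0#
  rowSetWeight-false k g = trans (*-congˡ (trans (*-congʳ (trans (*-congʳ (diag-corner k false)) (zeroˡ _))) (zeroˡ _))) (zeroʳ _)

  -- Every cell (0, q) lies in the triangle, so each chosen q > 0 gains 1 + v from row 0. Together
  -- with its sign 1 this is the weight x = 1 + v; the other rows are renumbered from 0.
  rowSetWeight-true : ∀ k g → rowSetWeight (suc k) (true ∷ g) ≈ weight k (1# + v) g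
  rowSetWeight-true k g = begin
    rowSetWeight (suc k) (true ∷ g)
      ≈⟨ *-congˡ (*-cong (*-cong (diag-corner k true) (∏-cong first-row))
           (triangleProd-cong k
             (λ p → trans (diag-inner (suc k) (toℕ p) (g p))
               (reflexive (≡.cong (λ a → factor ((a <ᵇ k) ∧ g p) z) (ℕₚ.+-suc (toℕ p) (toℕ p)))))
             (λ p q p<q → trans (off-diag (suc k) (suc (toℕ p)) (suc (toℕ q)) (g p) (g q) (s≤s p<q))
               (reflexive (≡.cong (λ a → factor ((a <ᵇ k) ∧ (g p ∧ g q)) w) (ℕₚ.+-suc (toℕ p) (toℕ q))))))) ⟩
    1# * ∏ (λ p → sign 1# (g p)) * (1# * ∏ (λ q → factor (g q) v) * tri)
      ≈⟨ solve 3 (λ a b c → con 1 :* a :* (con 1 :* b :* c) := a :* b :* c) refl _ _ _ ⟩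
    ∏ (λ p → sign 1# (g p)) * ∏ (λ q → factor (g q) v) * tri
      ≈⟨ *-congʳ (trans (sym (∏-distrib-* (λ p → sign 1# (g p)) _)) (∏-cong (λ p → sign-factor (g p) v))) ⟩
    weight k (1# + v) g ∎
    where
    tri = triangleProd k (λ p → diagFactor k (toℕ p) (g p)) (λ p q → pairFactor k (toℕ p) (toℕ q) (g p) (g q))
    first-row : ∀ q → ∑ bool (λ x → ∑ bool (λ y →
      pairWeight (suc k) 0 (suc (toℕ q)) true x y * pairWeight (suc k) (suc (toℕ q)) 0 (g q) y x)) ≈ factor (g q) v
    first-row q = trans (off-diag (suc k) 0 (suc (toℕ q)) true (g q) (s≤s z≤n))
      (reflexive (≡.cong (λ a → factor (a ∧ g q) v) (<⇒<ᵇ≡true (Finₚ.toℕ<n q))))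

  cellProd-ext : ∀ k → Extensional₂ {m = k} (λ N → cellProd N * someInRow N)
  cellProd-ext k eq = *-cong
    (∏²-cong (λ p q → reflexive (≡.cong₂ (cellWeight k (toℕ p) (toℕ q)) (eq p q) (eq q p))))
    (∏-cong (λ p → +-congʳ (-‿cong (∏-cong (λ q → reflexive (≡.cong (λ a → ⟦ not a ⟧) (eq p q)))))))

  cellProd-sum : ∀ k → ∑ (pi k (pi k bool)) (λ N → cellProd N * someInRow N) ≈ ∑ (pi k bool) (rowSetWeight k)
  cellProd-sum k = begin
    ∑ mats (λ N → cellProd N * someInRow N)
      ≈⟨ cong mats (λ N → *-congˡ (someInRow-expand N)) ⟩
    ∑ mats (λ N → cellProd N * ∑ sets (λ B → signs B * allowed B N))
      ≈⟨ exchange mats sets cellProd signs (λ N B → allowed B N) ⟩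
    ∑ sets (λ B → signs B * ∑ mats (λ N → cellProd N * allowed B N))
      ≈⟨ cong sets (λ B → *-congˡ (cong mats (λ N →
           sym (∏²-distrib-* (λ p q → cellWeight k (toℕ p) (toℕ q) (N p q) (N q p)) (λ p q → ⟦ B p ∨ not (N p q) ⟧))))) ⟩
    ∑ sets (λ B → signs B * ∑ mats (λ N → ∏² (λ p q → pairWeight k (toℕ p) (toℕ q) (B p) (N p q) (N q p))))
      ≈⟨ cong sets (λ B → *-congˡ (∑-∏-pairs bool k (λ p q → pairWeight k (toℕ p) (toℕ q) (B p)))) ⟩
    ∑ sets (rowSetWeight k) ∎
    where
    mats = pi k (pi k bool)
    sets = pi k bool
    signs : (Fin k → Bool) → Carrier
    signs B = ∏ (λ p → sign 1# (B p))
    allowed : (Fin k → Bool) → PMat k → Carrier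
    allowed B N = ∏² (λ p q → ⟦ B p ∨ not (N p q) ⟧)

  matrixSum≈rowSetSum : ∀ k → ∑ (pi (suc k) (pi (suc k) bool)) monomial ≈ rowSetSum k (1# + v)
  matrixSum≈rowSetSum k = begin
    ∑ mats monomial
      ≈⟨ cong mats monomial-flip ⟩
    ∑ mats (λ M → cellProd (flip M) * someInRow (flip M))
      ≈⟨ ∑-reverse-columns bool (suc k) (suc k) {λ N → cellProd N * someInRow N} (cellProd-ext (suc k)) ⟩
    ∑ mats (λ N → cellProd N * someInRow N)
      ≈⟨ cellProd-sum (suc k) ⟩
    ∑ (pi k bool) (λ g → rowSetWeight (suc k) (false ∷ g)) + ∑ (pi k bool) (λ g → rowSetWeight (suc k) (true ∷ g))
      ≈⟨ +-cong (trans (cong (pi k bool) (rowSetWeight-false k)) (∑-0 (pi k bool))) (cong (pi k bool) (rowSetWeight-true k)) ⟩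
    0# + rowSetSum k (1# + v)
      ≈⟨ +-identityˡ _ ⟩
    rowSetSum k (1# + v) ∎
    where
    mats = pi (suc k) (pi (suc k) bool)

-- The functional equation

[1+n]C2 : ∀ n → suc n C 2 ≡ n ℕ.+ n C 2
[1+n]C2 n = ≡.trans (≡.sym (nCk+nC[k+1]≡[n+1]C[k+1] n 1)) (≡.cong (ℕ._+ n C 2) (nC1≡n n))

module Unrolling (R : CommutativeRing 0ℓ 0ℓ) where
  open CommutativeRing R hiding (zero)
  open SetoidReasoning setoid
  open SemiringSolver commutativeSemiring using (solve; _:=_; _:+_; _:*_; con)
  open Exp commutativeSemiring using (_^_; ^-homo-*; ^-congʳ)
  open Sums R

  prodUpTo : ℕ → (ℕ → Carrier) → Carrier
  prodUpTo zero    F = 1#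
  prodUpTo (suc n) F = prodUpTo n F * F n

  stepProd : (ℕ → Carrier) → ℕ → Carrier
  stepProd step zero    = 1#
  stepProd step (suc n) = step n * stepProd step n

  -- A finite unrolling with an explicit remainder; no limit is taken, and the remainder is
  -- discarded later in each single degree.
  unroll : ∀ (F E step : ℕ → Carrier) → (∀ n → F n ≈ E n + step n * F (suc n)) →
           ∀ n → F 0 ≈ sumBelow n (λ i → stepProd step i * E i) + stepProd step n * F n
  unroll F E step eq zero    = sym (trans (+-identityˡ _) (*-identityˡ _))
  unroll F E step eq (suc n) = begin
    F 0
      ≈⟨ unroll F E step eq n ⟩
    sumBelow n term + stepProd step n * F n
      ≈⟨ +-congˡ (*-congˡ (eq n)) ⟩
    sumBelow n term + stepProd step n * (E n + step n * F (suc n))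
      ≈⟨ solve 5 (λ a b c d e → a :+ b :* (c :+ d :* e) := a :+ b :* c :+ d :* b :* e) refl _ _ _ _ _ ⟩
    sumBelow n term + term n + step n * stepProd step n * F (suc n)
      ≈⟨ +-congʳ (sumBelow-snoc n term) ⟨
    sumBelow (suc n) term + stepProd step (suc n) * F (suc n) ∎
    where
    term : ℕ → Carrier
    term i = stepProd step i * E i

  -- The exponents 0, ..., n - 1 of d add up to n C 2, which is the origin of the binomial exponent
  -- of 1 + w.
  stepProd-closed : ∀ t a b d (U : ℕ → Carrier) n →
    stepProd (λ i → t ^ 2 * U i * (a * (b * d ^ i))) n ≈
    t ^ (2 ℕ.* n) * (a ^ n * b ^ n * d ^ (n C 2) * prodUpTo n U)
  stepProd-closed t a b d U zero    = solve 0 (con 1 := con 1 :* (con 1 :* con 1 :* con 1 :* con 1)) refl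
  stepProd-closed t a b d U (suc n) = begin
    t ^ 2 * U n * (a * (b * d ^ n)) * stepProd _ n
      ≈⟨ *-congˡ (stepProd-closed t a b d U n) ⟩
    t ^ 2 * U n * (a * (b * d ^ n)) * (t ^ (2 ℕ.* n) * (a ^ n * b ^ n * d ^ (n C 2) * prodUpTo n U))
      ≈⟨ solve 10 (λ t2 u a b dn t2n an bn dc p → t2 :* u :* (a :* (b :* dn)) :* (t2n :* (an :* bn :* dc :* p)) :=
           (t2 :* t2n) :* ((a :* an) :* (b :* bn) :* (dn :* dc) :* (p :* u))) refl (t ^ 2) (U n) a b (d ^ n) _ _ _ _ _ ⟩
    (t ^ 2 * t ^ (2 ℕ.* n)) * (a ^ suc n * b ^ suc n * (d ^ n * d ^ (n C 2)) * prodUpTo (suc n) U)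
      ≈⟨ *-cong (trans (sym (^-homo-* t 2 (2 ℕ.* n))) (^-congʳ t (≡.sym (ℕₚ.*-suc 2 n))))
                (*-congʳ (*-congˡ (trans (sym (^-homo-* d n (n C 2))) (^-congʳ d (≡.sym ([1+n]C2 n)))))) ⟩
    t ^ (2 ℕ.* suc n) * (a ^ suc n * b ^ suc n * d ^ (suc n C 2) * prodUpTo (suc n) U) ∎

module GeneratingFunction (R : CommutativeRing 0ℓ 0ℓ) (v w z : CommutativeRing.Carrier R) where
  open CommutativeRing R hiding (zero)
  open PowerSeries R
  open Sums R
  open RowSets R w z
  private
    module U = Unrolling seriesRing
  open Exp S.commutativeSemiring using (_^_; ^-homo-*; ^-congˡ)
  open Exp commutativeSemiring using () renaming (_^_ to _^ᴿ_)

  -- The x_n of the overview, by recursion, so that the argument x * (1# + w) in `rowSetSum-2+` is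
  -- the next value by definition.
  scaled : ℕ → Carrier
  scaled zero    = 1# + v
  scaled (suc c) = scaled c * (1# + w)

  rowSetSeries : ℕ → Series
  rowSetSeries c k = rowSetSum k (scaled c)

  V̂ ρ : ℕ → Series
  V̂ n = (const v S.+ S.1#) S.* (const w S.+ S.1#) ^ n S.+ S.- S.1#
  ρ n = geometric (S.- (X ^ 2 S.* V̂ n))

  term : ℕ → Series
  term n =
    X ^ (2 ℕ.* n ℕ.+ 1)
    S.* (S.1# S.+ X S.* V̂ n) S.* ρ n
    S.* (S.1# S.+ const z) ^ n S.* (S.1# S.+ const v) ^ n S.* (S.1# S.+ const w) ^ (n C 2)
    S.* U.prodUpTo n (λ i → V̂ i S.* ρ i)

  scaled-closed : ∀ c → scaled c ≈ (1# + v) * (1# + w) ^ᴿ c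
  scaled-closed zero    = sym (*-identityʳ _)
  scaled-closed (suc c) = trans (*-congʳ (scaled-closed c)) (trans (*-assoc _ _ _) (*-congˡ (*-comm _ _)))

  const-scaled : ∀ c → const (scaled c) S.≈ ((S.1# S.+ const v) S.* (S.1# S.+ const w) ^ c)
  const-scaled c = S.trans (const-cong (scaled-closed c)) (S.trans (const-* _ _)
    (S.*-cong (const-+ 1# v) (S.trans (const-^ (1# + w) c) (^-congˡ c (const-+ 1# w)))))

  const-V : ∀ c → const (scaled c + - 1#) S.≈ V̂ c
  const-V c = S.trans (const-+ (scaled c) (- 1#)) (S.+-cong
    (S.trans (const-scaled c) (S.*-cong (S.+-comm S.1# (const v)) (^-congˡ c (S.+-comm S.1# (const w)))))
    (const-neg 1#))

  ρ-inverse : ∀ n → (S.1# S.+ X ^ 2 S.* V̂ n) S.* ρ n S.≈ S.1#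
  ρ-inverse n = begin
    (S.1# S.+ Y) S.* ρ n              ≈⟨ S.distribʳ (ρ n) S.1# Y ⟩
    S.1# S.* ρ n S.+ Y S.* ρ n        ≈⟨ S.+-congʳ {Y S.* ρ n} (S.trans (S.*-identityˡ (ρ n)) (geometric-unfold (S.- Y) -Y0)) ⟩
    S.1# S.+ S.- Y S.* ρ n S.+ Y S.* ρ n ≈⟨ S.+-assoc S.1# (S.- Y S.* ρ n) (Y S.* ρ n) ⟩
    S.1# S.+ (S.- Y S.* ρ n S.+ Y S.* ρ n) ≈⟨ S.+-congˡ {S.1#} (S.distribʳ (ρ n) (S.- Y) Y) ⟨
    S.1# S.+ (S.- Y S.+ Y) S.* ρ n    ≈⟨ S.+-congˡ {S.1#} (S.trans (S.*-congʳ {ρ n} (S.-‿inverseˡ Y)) (S.zeroˡ (ρ n))) ⟩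
    S.1# S.+ S.0#                     ≈⟨ S.+-identityʳ S.1# ⟩
    S.1# ∎
    where
    open SetoidReasoning S.setoid
    Y = X ^ 2 S.* V̂ n
    -Y0 : - (X ^ 2 S.* V̂ n) 0 ≈ 0#
    -Y0 = trans (-‿cong (trans (*-congʳ (zeroˡ _)) (zeroˡ _))) (RingProperties.-0#≈0# ring)

  X²∙-2+ : ∀ f n → (X ^ 2 S.* f) (2 ℕ.+ n) ≈ f n
  X²∙-2+ f n = trans (∙-cong {g = f} (S.*-congˡ {X} (S.*-identityʳ X)) (λ i → refl) (2 ℕ.+ n))
    (trans (∙-assoc X X f (2 ℕ.+ n)) (trans (X∙-suc (X ∙ f) (suc n)) (X∙-suc f n)))

  X²∙-1 : ∀ f → (X ^ 2 S.* f) 1 ≈ 0#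
  X²∙-1 f = trans (∙-cong {g = f} (S.*-congˡ {X} (S.*-identityʳ X)) (λ i → refl) 1)
    (trans (∙-assoc X X f 1) (trans (X∙-suc (X ∙ f) 0) (zeroˡ _)))

  X²∙-0 : ∀ f → (X ^ 2 S.* f) 0 ≈ 0#
  X²∙-0 f = trans (*-congʳ (zeroˡ _)) (zeroˡ _)

  gain : ℕ → Series
  gain c = (S.1# S.+ const z) S.* ((S.1# S.+ const v) S.* (S.1# S.+ const w) ^ c)

  const-gain : ∀ c → const ((1# + z) * scaled c) S.≈ gain c
  const-gain c = S.trans (const-* _ _) (S.*-cong (const-+ 1# z) (const-scaled c))

  -- Compared degree by degree: 0 and 1 are the initial values of `rowSetSum`, and degree k + 2 is
  -- `rowSetSum-2+`, whose negative term is moved to the left-hand side.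
  functional-equation-const : ∀ c → let V = const (scaled c + - 1#) in
    rowSetSeries c S.+ X ^ 2 S.* (V S.* rowSetSeries c) S.≈
    S.1# S.+ X S.* V S.+ X ^ 2 S.* (V S.* (const ((1# + z) * scaled c) S.* rowSetSeries (suc c)))
  functional-equation-const c zero = trans
    (+-cong (rowSetSum-0 (scaled c)) (X²∙-0 (const (scaled c + - 1#) S.* rowSetSeries c)))
    (sym (+-cong (trans (+-congˡ (zeroˡ _)) (+-identityʳ _)) (X²∙-0 (const (scaled c + - 1#) S.* (const ((1# + z) * scaled c) S.* rowSetSeries (suc c))))))
  functional-equation-const c (suc zero) = trans
    (+-cong (rowSetSum-1 (scaled c)) (X²∙-1 (const (scaled c + - 1#) S.* rowSetSeries c)))
    (sym (+-cong (trans (+-congˡ (X∙-suc (const (scaled c + - 1#)) 0)) (+-identityˡ _))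
      (X²∙-1 (const (scaled c + - 1#) S.* (const ((1# + z) * scaled c) S.* rowSetSeries (suc c))))))
  functional-equation-const c (suc (suc k)) = begin
    rowSetSum (2 ℕ.+ k) x + (X ^ 2 S.* (const V S.* rowSetSeries c)) (2 ℕ.+ k)
      ≈⟨ +-cong (rowSetSum-2+ k x) (trans (X²∙-2+ _ k) (const-∙ V (rowSetSeries c) k)) ⟩
    V * (x * (1# + z) * rowSetSum k (x * (1# + w)) + - 1# * rowSetSum k x) + V * rowSetSum k x
      -- - 1# is treated as a variable m; the terms without rescaled argument collect to a multiple
      -- of m + 1, which vanishes.
      ≈⟨ solve 6 (λ V x z m f g → V :* (x :* z :* g :+ m :* f) :+ V :* f := V :* (z :* x :* g) :+ V :* f :* (m :+ con 1)) refl
           V x (1# + z) (- 1#) (rowSetSum k x) (rowSetSum k (x * (1# + w))) ⟩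
    V * ((1# + z) * x * rowSetSum k (x * (1# + w))) + V * rowSetSum k x * (- 1# + 1#)
      ≈⟨ trans (+-congˡ (trans (*-congˡ (-‿inverseˡ 1#)) (zeroʳ _))) (+-comm _ _) ⟩
    0# + V * ((1# + z) * x * rowSetSum k (x * (1# + w)))
      ≈⟨ +-cong (trans (+-congˡ (X∙-suc (const V) (suc k))) (+-identityˡ _))
                (trans (X²∙-2+ _ k) (trans (const-∙ V _ k) (*-congˡ (const-∙ _ (rowSetSeries (suc c)) k)))) ⟨
    (0# + (X S.* const V) (2 ℕ.+ k)) + (X ^ 2 S.* (const V S.* (const ((1# + z) * x) S.* rowSetSeries (suc c)))) (2 ℕ.+ k) ∎
    where
    open SetoidReasoning setoid
    open SemiringSolver commutativeSemiring using (solve; _:=_; _:+_; _:*_; con)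
    x = scaled c
    V = x + - 1#

  functional-equation : ∀ c →
    rowSetSeries c S.+ X ^ 2 S.* (V̂ c S.* rowSetSeries c) S.≈
    S.1# S.+ X S.* V̂ c S.+ X ^ 2 S.* (V̂ c S.* (gain c S.* rowSetSeries (suc c)))
  functional-equation c = S.trans
    (S.+-congˡ {F} (S.*-congˡ {X ^ 2} (S.*-congʳ {F} (S.sym (const-V c)))))
    (S.trans (functional-equation-const c)
      (S.+-cong (S.+-congˡ {S.1#} (S.*-congˡ {X} (const-V c)))
                (S.*-congˡ {X ^ 2} (S.*-cong (const-V c) (S.*-congʳ {rowSetSeries (suc c)} (const-gain c))))))
    where F = rowSetSeries c

  E step : ℕ → Series
  E n = (S.1# S.+ X S.* V̂ n) S.* ρ n
  step n = X ^ 2 S.* (V̂ n S.* ρ n) S.* gain n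

  -- The functional equation divided by 1 + t² V_n: the product in `ρ-inverse` is inserted, its
  -- first factor restores the left-hand side of the equation, and ρ n remains.
  rowSetSeries-unroll : ∀ n → rowSetSeries n S.≈ E n S.+ step n S.* rowSetSeries (suc n)
  rowSetSeries-unroll n = begin
    F
      ≈⟨ S.*-identityˡ F ⟨
    S.1# S.* F
      ≈⟨ S.*-congʳ {F} (ρ-inverse n) ⟨
    (S.1# S.+ X ^ 2 S.* V̂ n) S.* ρ n S.* F
      ≈⟨ solve 4 (λ t v r f → (con 1 :+ t :* v) :* r :* f := (f :+ t :* (v :* f)) :* r) S.refl (X ^ 2) (V̂ n) (ρ n) F ⟩
    (F S.+ X ^ 2 S.* (V̂ n S.* F)) S.* ρ n
      ≈⟨ S.*-congʳ {ρ n} (functional-equation n) ⟩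
    (S.1# S.+ X S.* V̂ n S.+ X ^ 2 S.* (V̂ n S.* (gain n S.* F′))) S.* ρ n
      ≈⟨ solve 6 (λ e t v g f r → (e :+ t :* (v :* (g :* f))) :* r := e :* r :+ t :* (v :* r) :* g :* f) S.refl
           (S.1# S.+ X S.* V̂ n) (X ^ 2) (V̂ n) (gain n) F′ (ρ n) ⟩
    E n S.+ step n S.* F′ ∎
    where
    open SetoidReasoning S.setoid
    open SemiringSolver S.commutativeSemiring using (solve; _:=_; _:+_; _:*_; con)
    F = rowSetSeries n
    F′ = rowSetSeries (suc n)

  D : ℕ → Series
  D = U.stepProd step

  term-closed : ∀ n → term n S.≈ X S.* (D n S.* E n)
  term-closed n = begin
    X ^ (2 ℕ.* n ℕ.+ 1) S.* e S.* ρ n S.* a S.* b S.* d S.* p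
      ≈⟨ S.*-congʳ {p} (S.*-congʳ {d} (S.*-congʳ {b} (S.*-congʳ {a} (S.*-congʳ {ρ n} (S.*-congʳ {e}
           (^-homo-* X (2 ℕ.* n) 1)))))) ⟩
    (X ^ (2 ℕ.* n) S.* (X S.* S.1#)) S.* e S.* ρ n S.* a S.* b S.* d S.* p
      ≈⟨ solve 8 (λ t x e r a b d p → (t :* (x :* con 1)) :* e :* r :* a :* b :* d :* p := x :* (t :* (a :* b :* d :* p) :* (e :* r)))
           S.refl (X ^ (2 ℕ.* n)) X e (ρ n) a b d p ⟩
    X S.* (X ^ (2 ℕ.* n) S.* (a S.* b S.* d S.* p) S.* E n)
      ≈⟨ S.*-congˡ {X} (S.*-congʳ {E n} (U.stepProd-closed X (S.1# S.+ const z) (S.1# S.+ const v) (S.1# S.+ const w) (λ i → V̂ i S.* ρ i) n)) ⟨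
    X S.* (D n S.* E n) ∎
    where
    open SetoidReasoning S.setoid
    open SemiringSolver S.commutativeSemiring using (solve; _:=_; _:+_; _:*_; con)
    e = S.1# S.+ X S.* V̂ n
    a = (S.1# S.+ const z) ^ n
    b = (S.1# S.+ const v) ^ n
    d = (S.1# S.+ const w) ^ (n C 2)
    p = U.prodUpTo n (λ i → V̂ i S.* ρ i)

  D-vanishes : ∀ n i → i ℕ.< n → D n i ≈ 0#
  D-vanishes (suc n) = ∙-vanishes-suc (step n) (D n) n
    (trans (*-congʳ (trans (*-congʳ (zeroˡ _)) (zeroˡ _))) (zeroˡ _)) (D-vanishes n)

  -- Unrolling k + 1 times leaves a remainder whose factor `D (suc k)` has order greater than k, so
  -- degree k of the full series is that of the partial sum.
  term-sum : ∀ k → sumBelow (suc k) (λ n → term n k) ≈ (X S.* rowSetSeries 0) k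
  term-sum k = begin
    sumBelow (suc k) (λ n → term n k)
      ≈⟨ sumBelow-cong (suc k) {λ n → term n k} {λ n → (X S.* (D n S.* E n)) k} (λ n _ → term-closed n k) ⟩
    sumBelow (suc k) (λ n → (X S.* (D n S.* E n)) k)
      ≈⟨ sumBelow-coeff (suc k) (λ n → X S.* (D n S.* E n)) k ⟨
    SS.sumBelow (suc k) (λ n → X S.* (D n S.* E n)) k
      ≈⟨ SS.*-distribˡ-sumBelow X (suc k) (λ n → D n S.* E n) k ⟨
    (X S.* partial) k
      ≈⟨ +-identityʳ _ ⟨
    (X S.* partial) k + 0#
      ≈⟨ +-congˡ rest ⟨
    (X S.* partial) k + (X S.* (D (suc k) S.* rowSetSeries (suc k))) k
      ≈⟨ S.distribˡ X partial (D (suc k) S.* rowSetSeries (suc k)) k ⟨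
    (X S.* (partial S.+ D (suc k) S.* rowSetSeries (suc k))) k
      ≈⟨ S.*-congˡ {X} (U.unroll rowSetSeries E step rowSetSeries-unroll (suc k)) k ⟨
    (X S.* rowSetSeries 0) k ∎
    where
    open SetoidReasoning setoid
    partial = SS.sumBelow (suc k) (λ n → D n S.* E n)
    rest : (X S.* (D (suc k) S.* rowSetSeries (suc k))) k ≈ 0#
    rest = trans (∙-cong≤ k {X} {X} {g′ = λ _ → 0#} (λ i _ → refl) (λ i i≤k →
      trans (∙-cong≤ i {f′ = λ _ → 0#} (λ j j≤i → D-vanishes (suc k) j (s≤s (ℕₚ.≤-trans j≤i i≤k))) (λ j _ → refl))
            (∙-zeroˡ (rowSetSeries (suc k)) i))) (S.zeroʳ X k)

-- Comparison with FPS

module Monomials (R : CommutativeRing 0ℓ 0ℓ) where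
  open CommutativeRing R hiding (zero)
  open PowerSeries R
  open Exp S.commutativeSemiring using (_^_)

  X^-const : ∀ m y n → (X ^ m S.* const y) n ≈ (if m ≡ᵇ n then y else 0#)
  X^-const zero    y zero    = *-identityˡ y
  X^-const zero    y (suc n) = ∙-identityˡ (const y) (suc n)
  X^-const (suc m) y zero    = trans (*-congʳ (zeroˡ _)) (zeroˡ _)
  X^-const (suc m) y (suc n) = trans (∙-assoc X (X ^ m) (const y) (suc n))
    (trans (X∙-suc (X ^ m ∙ const y) n) (X^-const m y n))

  const-mon : ∀ x n y → (const x ^ n S.* const y) S.≈ const (x E.^ n * y)
  const-mon x n y = S.sym (S.trans (const-* (x E.^ n) y) (S.*-congʳ {const y} (const-^ x n)))

  ⟦⟧-const : ∀ b → Brackets.⟦_⟧ seriesRing b S.≈ const (Brackets.⟦_⟧ R b)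
  ⟦⟧-const true  n       = refl
  ⟦⟧-const false zero    = refl
  ⟦⟧-const false (suc n) = refl

ℤᴿ : CommutativeRing 0ℓ 0ℓ
ℤᴿ = ℤₚ.+-*-commutativeRing

open Sums ℤᴿ

Σ≤-sumBelow : ∀ n f → Σ≤ n f ≡ sumBelow (suc n) f
Σ≤-sumBelow n f = go (suc n) id
  where
  -- `upTo` is `applyUpTo id`, and the induction moves `suc` into the generating function, so g must
  -- be general.
  go : ∀ n (g : ℕ → ℕ) → sumℤ (map f (applyUpTo g n)) ≡ sumBelow n (f ∘ g)
  go zero    g = ≡.refl
  go (suc n) g = ≡.cong (λ s → f (g 0) ℤ.+ s) (go n (g ∘ suc))

Σ≤-cong : ∀ n {f g : ℕ → ℤ} → (∀ i → f i ≡ g i) → Σ≤ n f ≡ Σ≤ n g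
Σ≤-cong n {f} {g} eq = ≡.trans (Σ≤-sumBelow n f)
  (≡.trans (sumBelow-cong (suc n) (λ i _ → eq i)) (≡.sym (Σ≤-sumBelow n g)))

-- The ring of coefficients of the powers of t, kept abstract so that products of power series do not unfold to four-fold
-- convolutions.
record CoefficientRing (P : CommutativeRing 0ℓ 0ℓ) : Set where
  open CommutativeRing P
  open Exp commutativeSemiring using (_^_)
  field
    coeff       : Carrier → ℕ → ℕ → ℕ → ℤ
    v w z       : Carrier
    coeff-cong  : ∀ {x y} → x ≈ y → ∀ a b c → coeff x a b c ≡ coeff y a b c
    coeff-+     : ∀ x y a b c → coeff (x + y) a b c ≡ coeff x a b c ℤ.+ coeff y a b c
    coeff-neg   : ∀ x a b c → coeff (- x) a b c ≡ ℤ.- coeff x a b c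
    coeff-*     : ∀ x y a b c → coeff (x * y) a b c ≡
      Σ≤ a λ a₁ → Σ≤ b λ b₁ → Σ≤ c λ c₁ → coeff x a₁ b₁ c₁ ℤ.* coeff y (a ∸ a₁) (b ∸ b₁) (c ∸ c₁)
    coeff-0     : ∀ a b c → coeff 0# a b c ≡ + 0
    coeff-1     : ∀ a b c → coeff 1# a b c ≡ 𝟙 0 a b c
    coeff-v     : ∀ a b c → coeff v a b c ≡ 𝕧 0 a b c
    coeff-w     : ∀ a b c → coeff w a b c ≡ 𝕨 0 a b c
    coeff-z     : ∀ a b c → coeff z a b c ≡ 𝕫 0 a b c
    coeff-mon   : ∀ m n l e a b c → coeff (v ^ m * (w ^ n * (z ^ l * Brackets.⟦_⟧ P e))) a b c ≡
      + b2n (e ∧ (m ≡ᵇ a) ∧ (n ≡ᵇ b) ∧ (l ≡ᵇ c))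

module Transfer {P : CommutativeRing 0ℓ 0ℓ} (K : CoefficientRing P) where
  open CoefficientRing K
  open PowerSeries P
  open Exp S.commutativeSemiring using (_^_)
  open GeneratingFunction P v w z
  open Unrolling seriesRing using (prodUpTo)
  open CommutativeRing P using () renaming (_*_ to _*ᴾ_)
  private module P = Sums P

  infix 4 _≐_
  -- A record and not a plain function type, so that f and g can be read off from the type.
  record _≐_ (f : FPS) (g : Series) : Set where
    field at : ∀ k a b c → f k a b c ≡ coeff (g k) a b c
  open _≐_

  coeff-sumBelow : ∀ n F a b c → coeff (P.sumBelow n F) a b c ≡ sumBelow n (λ i → coeff (F i) a b c)
  coeff-sumBelow zero    F a b c = coeff-0 a b c
  coeff-sumBelow (suc n) F a b c = ≡.trans (coeff-+ (F 0) _ a b c) (≡.cong (λ s → coeff (F 0) a b c ℤ.+ s) (coeff-sumBelow n (F ∘ suc) a b c))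

  coeff-Σ≤ : ∀ n F a b c → coeff (P.sumBelow (suc n) F) a b c ≡ Σ≤ n (λ i → coeff (F i) a b c)
  coeff-Σ≤ n F a b c = ≡.trans (coeff-sumBelow (suc n) F a b c) (≡.sym (Σ≤-sumBelow n (λ i → coeff (F i) a b c)))

  -- The fourfold convolution splits: the outer sum is the product in t, the three inner ones are
  -- the product of the coefficient ring.
  ⊗-cong : ∀ {f f′ g g′} → f ≐ f′ → g ≐ g′ → (f ⊗ g) ≐ (f′ S.* g′)
  ⊗-cong {f} {f′} {g} {g′} p q .at k a b c = ≡.trans
    (Σ≤-cong k (λ k₁ → ≡.trans
      (Σ≤-cong a (λ a₁ → Σ≤-cong b (λ b₁ → Σ≤-cong c (λ c₁ →
        ≡.cong₂ ℤ._*_ (p .at k₁ a₁ b₁ c₁) (q .at (k ∸ k₁) (a ∸ a₁) (b ∸ b₁) (c ∸ c₁))))))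
      (≡.sym (coeff-* (f′ k₁) (g′ (k ∸ k₁)) a b c))))
    (≡.sym (≡.trans (coeff-cong (∙-sumBelow f′ g′ k) a b c) (coeff-Σ≤ k (λ i → f′ i *ᴾ g′ (k ∸ i)) a b c)))

  ⊕-cong : ∀ {f f′ g g′} → f ≐ f′ → g ≐ g′ → (f ⊕ g) ≐ (f′ S.+ g′)
  ⊕-cong {f′ = f′} {g′ = g′} p q .at k a b c =
    ≡.trans (≡.cong₂ ℤ._+_ (p .at k a b c) (q .at k a b c)) (≡.sym (coeff-+ (f′ k) (g′ k) a b c))

  neg-cong : ∀ {f f′} → f ≐ f′ → neg f ≐ (S.- f′)
  neg-cong {f′ = f′} p .at k a b c = ≡.trans (≡.cong (λ n → ℤ.- n) (p .at k a b c)) (≡.sym (coeff-neg (f′ k) a b c))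

  𝟙-1# : 𝟙 ≐ S.1#
  𝟙-1# .at zero    a b c = ≡.sym (coeff-1 a b c)
  𝟙-1# .at (suc k) a b c = ≡.sym (coeff-0 a b c)

  𝕥-X : 𝕥 ≐ X
  𝕥-X .at zero    a b c = ≡.sym (coeff-0 a b c)
  𝕥-X .at (suc k) a b c = 𝟙-1# .at k a b c

  𝕧-const : 𝕧 ≐ const v
  𝕧-const .at zero    a b c = ≡.sym (coeff-v a b c)
  𝕧-const .at (suc k) a b c = ≡.sym (coeff-0 a b c)

  𝕨-const : 𝕨 ≐ const w
  𝕨-const .at zero    a b c = ≡.sym (coeff-w a b c)
  𝕨-const .at (suc k) a b c = ≡.sym (coeff-0 a b c)

  𝕫-const : 𝕫 ≐ const z
  𝕫-const .at zero    a b c = ≡.sym (coeff-z a b c)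
  𝕫-const .at (suc k) a b c = ≡.sym (coeff-0 a b c)

  ^^-cong : ∀ {f f′} n → f ≐ f′ → (f ^^ n) ≐ (f′ ^ n)
  ^^-cong zero    p = 𝟙-1#
  ^^-cong (suc n) p = ⊗-cong p (^^-cong n p)

  recip1p-cong : ∀ {f f′} → f ≐ f′ → recip1p f ≐ geometric (S.- f′)
  recip1p-cong {f} {f′} p .at k a b c = ≡.trans
    (Σ≤-cong k (λ m → ^^-cong m (neg-cong p) .at k a b c))
    (≡.sym (coeff-Σ≤ k (λ m → ((S.- f′) ^ m) k) a b c))

  prodBelow-cong : ∀ n {F : ℕ → FPS} {F′ : ℕ → Series} → (∀ i → F i ≐ F′ i) → prodBelow n F ≐ prodUpTo n F′
  prodBelow-cong zero    p = 𝟙-1#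
  prodBelow-cong (suc n) p = ⊗-cong (prodBelow-cong n p) (p n)

  -- The let makes Agda infer the implicit arguments from the factors; unifying with the goal first would unfold _⊗_.
  Vser-V̂ : ∀ n → Vser n 𝕧 𝕨 ≐ V̂ n
  Vser-V̂ n = let p = ⊕-cong (⊗-cong (⊕-cong 𝕧-const 𝟙-1#) (^^-cong n (⊕-cong 𝕨-const 𝟙-1#))) (neg-cong 𝟙-1#) in p

  recip1p-ρ : ∀ n → recip1p (𝕥 ^^ 2 ⊗ Vser n 𝕧 𝕨) ≐ ρ n
  recip1p-ρ n = let p = recip1p-cong (⊗-cong (^^-cong 2 𝕥-X) (Vser-V̂ n)) in p

  rhsTerm-term : ∀ n → rhsTerm n ≐ term n
  rhsTerm-term n =
    let p = ⊗-cong (⊗-cong (⊗-cong (⊗-cong (⊗-cong (⊗-cong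
              (^^-cong (2 ℕ.* n ℕ.+ 1) 𝕥-X)
              (⊕-cong 𝟙-1# (⊗-cong 𝕥-X (Vser-V̂ n))))
              (recip1p-ρ n))
              (^^-cong n (⊕-cong 𝟙-1# 𝕫-const)))
              (^^-cong n (⊕-cong 𝟙-1# 𝕧-const)))
              (^^-cong (n C 2) (⊕-cong 𝟙-1# 𝕨-const)))
              (prodBelow-cong n (λ i → let q = ⊗-cong (Vser-V̂ i) (recip1p-ρ i) in q))
    in p

  rhs-coeff : ∀ k a b c → rhs k a b c ≡ coeff ((X S.* rowSetSeries 0) k) a b c
  rhs-coeff k a b c = ≡.trans
    (Σ≤-cong k {λ n → rhsTerm n k a b c} {λ n → coeff (term n k) a b c} (λ n → rhsTerm-term n .at k a b c))
    (≡.trans (≡.sym (coeff-Σ≤ k (λ n → term n k) a b c)) (coeff-cong (term-sum k) a b c))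

  open Enumeration P
  open Summation
  open MatrixSum P v w z

  module _ (a b c : ℕ) where
    -- Counting with `s` in ℕ agrees with extracting a coefficient from the sum by `t`. Additivity
    -- of coefficients gives this for `bool`, and it lifts to functions because `pi` has the
    -- recursion of `sumPi`.
    Counts : ∀ {A : Set} → Summer A → Summation A → Set
    Counts {A} s t = ∀ (f : A → ℕ) g → (∀ x → + f x ≡ coeff (g x) a b c) → + s f ≡ coeff (∑ t g) a b c

    bool-counts : Counts sumBool bool
    bool-counts f g eq = ≡.trans (≡.cong₂ ℤ._+_ (eq false) (eq true)) (≡.sym (coeff-+ _ _ a b c))

    pi-counts : ∀ {A : Set} n {s : Summer A} {t} → Counts s t → Counts (sumPi n s) (pi n t)
    pi-counts zero    h f g eq = eq (λ ())
    pi-counts (suc n) h f g eq = h _ _ (λ x → pi-counts n h _ _ (λ r → eq (x ∷ r)))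

  gf-coeff : ∀ k a b c → SPlusGF k a b c ≡ coeff ((X S.* rowSetSeries 0) k) a b c
  -- The empty matrix has no corner cell, so its count computes to 0.
  gf-coeff zero    a b c = ≡.sym (≡.trans (coeff-cong (CommutativeRing.zeroˡ P _) a b c) (coeff-0 a b c))
  gf-coeff (suc k) a b c = ≡.trans
    (pi-counts a b c (suc k) (pi-counts a b c (suc k) (bool-counts a b c)) _ monomial
      (λ M → ≡.sym (coeff-mon (statMax M) (statSe M) (statDg M) (inSPlus M) a b c)))
    (coeff-cong (CommutativeRing.trans P (matrixSum≈rowSetSum k) (CommutativeRing.sym P (X∙-suc (rowSetSeries 0) k))) a b c)

  gf≡rhs : ∀ k a b c → SPlusGF k a b c ≡ rhs k a b c
  gf≡rhs k a b c = ≡.trans (gf-coeff k a b c) (≡.sym (rhs-coeff k a b c))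

-- The tower ℤ[[z]][[w]][[v]]. With v outermost, application to a, b, c in this order is the
-- coefficient of v^a w^b z^c, so `coeff` can be the identity.
module Z = PowerSeries ℤᴿ
module W = PowerSeries Z.seriesRing
module V = PowerSeries W.seriesRing

seriesCoefficients : CoefficientRing V.seriesRing
seriesCoefficients = record
  { coeff      = λ f → f
  ; v          = v
  ; w          = w
  ; z          = z
  ; coeff-cong = λ eq → eq
  ; coeff-+    = λ _ _ _ _ _ → ≡.refl
  ; coeff-neg  = λ _ _ _ _ → ≡.refl
  ; coeff-*    = convolution
  ; coeff-0    = λ _ _ _ → ≡.refl
  ; coeff-1    = one
  ; coeff-v    = λ { zero b c → ≡.refl ; (suc a) b c → one a b c }
  ; coeff-w    = λ { zero zero c → ≡.refl ; zero (suc b) c → one zero b c ; (suc a) b c → ≡.refl }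
  ; coeff-z    = λ { zero zero zero → ≡.refl ; zero zero (suc c) → one zero zero c ; zero (suc b) c → ≡.refl ; (suc a) b c → ≡.refl }
  ; coeff-mon  = mons
  }
  where
  v w z : V.Series
  v = V.X
  w = V.const W.X
  z = V.const (W.const Z.X)

  one : ∀ a b c → V.const (W.const (Z.const (+ 1))) a b c ≡ 𝟙 0 a b c
  one zero    zero    zero    = ≡.refl
  one zero    zero    (suc c) = ≡.refl
  one zero    (suc b) c       = ≡.refl
  one (suc a) b       c       = ≡.refl

  convolution : ∀ (f g : V.Series) a b c → (f V.∙ g) a b c ≡
    Σ≤ a λ a₁ → Σ≤ b λ b₁ → Σ≤ c λ c₁ → f a₁ b₁ c₁ ℤ.* g (a ∸ a₁) (b ∸ b₁) (c ∸ c₁)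
  convolution f g a b c = ≡.trans (V.∙-sumBelow f g a b c)
    (≡.trans (W.sumBelow-coeff (suc a) (λ a₁ → f a₁ W.∙ g (a ∸ a₁)) b c)
    (≡.trans (Z.sumBelow-coeff (suc a) (λ a₁ → (f a₁ W.∙ g (a ∸ a₁)) b) c)
    (≡.trans (≡.sym (Σ≤-sumBelow a (λ a₁ → (f a₁ W.∙ g (a ∸ a₁)) b c)))
    (Σ≤-cong a λ a₁ → ≡.trans (W.∙-sumBelow (f a₁) (g (a ∸ a₁)) b c)
      (≡.trans (Z.sumBelow-coeff (suc b) (λ b₁ → f a₁ b₁ Z.∙ g (a ∸ a₁) (b ∸ b₁)) c)
      (≡.trans (≡.sym (Σ≤-sumBelow b (λ b₁ → (f a₁ b₁ Z.∙ g (a ∸ a₁) (b ∸ b₁)) c)))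
      (Σ≤-cong b λ b₁ → ≡.trans (Z.∙-sumBelow (f a₁ b₁) (g (a ∸ a₁) (b ∸ b₁)) c)
        (≡.sym (Σ≤-sumBelow c (λ c₁ → f a₁ b₁ c₁ ℤ.* g (a ∸ a₁) (b ∸ b₁) (c ∸ c₁)))))))))))

  module MZ = Monomials ℤᴿ
  module MW = Monomials Z.seriesRing
  module MV = Monomials W.seriesRing
  open Exp Z.S.commutativeSemiring using () renaming (_^_ to _^ᶻ_)
  open Exp W.S.commutativeSemiring using () renaming (_^_ to _^ʷ_)
  open Exp V.S.commutativeSemiring using () renaming (_^_ to _^ᵛ_)
  open Brackets ℤᴿ using () renaming (⟦_⟧ to ⟦_⟧ᶻ)

  -- The tower tests one exponent at a time, with the indicator of e innermost; the count tests a
  -- single conjunction with e in front.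
  select : ∀ p q r e (s : W.Series) (u : Z.Series) b c →
    s b c ≡ (if q then u else Z.S.0#) c → u c ≡ (if r then ⟦ e ⟧ᶻ else + 0) →
    (if p then s else W.S.0#) b c ≡ + b2n (e ∧ p ∧ q ∧ r)
  select false q     r     true  s u b c hs hu = ≡.refl
  select false q     r     false s u b c hs hu = ≡.refl
  select true  false r     true  s u b c hs hu = hs
  select true  false r     false s u b c hs hu = hs
  select true  true  false true  s u b c hs hu = ≡.trans hs hu
  select true  true  false false s u b c hs hu = ≡.trans hs hu
  select true  true  true  true  s u b c hs hu = ≡.trans hs hu
  select true  true  true  false s u b c hs hu = ≡.trans hs hu

  mons : ∀ m n l e a b c → (v ^ᵛ m V.∙ (w ^ᵛ n V.∙ (z ^ᵛ l V.∙ Brackets.⟦_⟧ V.seriesRing e))) a b c ≡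
    + b2n (e ∧ (m ≡ᵇ a) ∧ (n ≡ᵇ b) ∧ (l ≡ᵇ c))
  mons m n l e a b c = ≡.trans
    (≡.trans (V.S.*-congˡ {v ^ᵛ m} nested a b c) (MV.X^-const m s a b c))
    (select (m ≡ᵇ a) (n ≡ᵇ b) (l ≡ᵇ c) e s u b c (MW.X^-const n u b c) (MZ.X^-const l ⟦ e ⟧ᶻ c))
    where
    u : Z.Series
    u = Z.X ^ᶻ l Z.∙ Z.const ⟦ e ⟧ᶻ
    s : W.Series
    s = W.X ^ʷ n W.∙ W.const u
    inner : (z ^ᵛ l V.∙ Brackets.⟦_⟧ V.seriesRing e) V.S.≈ V.const (W.const u)
    inner = V.S.trans (V.S.*-congˡ {z ^ᵛ l} (MV.⟦⟧-const e)) (V.S.trans (MV.const-mon (W.const Z.X) l (Brackets.⟦_⟧ W.seriesRing e))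
      (V.const-cong (W.S.trans (W.S.*-congˡ {W.const Z.X ^ʷ l} (MW.⟦⟧-const e)) (W.S.trans (MW.const-mon Z.X l (Brackets.⟦_⟧ Z.seriesRing e))
        (W.const-cong (Z.S.*-congˡ {Z.X ^ᶻ l} (MZ.⟦⟧-const e)))))))
    nested : (w ^ᵛ n V.∙ (z ^ᵛ l V.∙ Brackets.⟦_⟧ V.seriesRing e)) V.S.≈ V.const s
    nested = V.S.trans (V.S.*-congˡ {w ^ᵛ n} inner) (MV.const-mon W.X n (W.const u))

theorem9 : ∀ k a b c → SPlusGF k a b c ≡ rhs k a b c
theorem9 = Transfer.gf≡rhs seriesCoefficients
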